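{- For every $\ell\ge1$, the reachability problem is decidable for reversible Petri nets with data $\mathcal{Q}^{\otimes\ell}$.
   Context: $\mathcal{Q}=(\mathbb{Q},\le)$ is the rational order. Embeddings of a relational structure are maps preserving and reflecting all relations; $\mathrm{Emb}(\mathcal{C})$ denotes them. The lexicographic product $\mathcal{A}\otimes\mathcal{A}'$ has carrier $A\times A'$; each $k$-ary relation $r$ of $\mathcal{A}$ holds of $((a_1,a'_1),\dots,(a_k,a'_k))$ iff $r(a_1,\dots,a_k)$, and each $k$-ary relation $r'$ of $\mathcal{A}'$ holds iff $a_1=\dots=a_k$ and $r'(a'_1,\dots,a'_k)$; $\mathcal{A}^{\otimes\ell}$ is the $\ell$-fold product and $\mathbf{d}=(\{0,\dots,d-1\},\le)$. $M[\mathcal{C}]$ is the monoid of monomials with variables the elements of $\mathcal{C}$; embeddings act by renaming variables. A Petri net with data $\mathcal{A}$ with $d$ places is a set $\mathcal{T}=\{(\iota(h),\iota(h')):\iota\in\mathrm{Emb}(\mathcal{A}\otimes\mathbf{d}),(h,h')\in T\}$ for a finite $T\subseteq M[\mathcal{A}\otimes\mathbf{d}]^2$ (the presentation); transitions are $g\cdot h\to g\cdot h'$ for $g$ a monomial and $(h,h')\in\mathcal{T}$, and $\to^*$ is the reflexive-transitive closure. The net is reversible if $c\to^*c'$ implies $c'\to^*c$. The reachability problem: given $d$, a presentation $T$ of a reversible net, and monomials $s,t$, decide whether $s\to^*t$. -}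

module Defs where

open import Data.Nat using (ℕ)
open import Data.Fin using (Fin)
import Data.Fin as Fin
open import Data.Vec using (Vec; lookup)
open import Data.Rational using (ℚ)
import Data.Rational as ℚ
open import Data.Product using (_×_; _,_; Σ; ∃; proj₁; proj₂)
open import Data.Sum using (_⊎_)
open import Data.List using (List; _++_; map)
open import Data.List.Membership.Propositional using (_∈_)
open import Data.List.Relation.Binary.Permutation.Propositional using (_↭_)
open import Relation.Binary.PropositionalEquality using (_≡_)
open import Relation.Binary.Construct.Closure.ReflexiveTransitive using (Star)

-- Carrier of the structure Q^{⊗ℓ} ⊗ d : tuples of ℓ rationals paired with a place in {0,…,d-1}.
Elem : ℕ → ℕ → Set
Elem ℓ d = Vec ℚ ℓ × Fin d

-- The i-th binary relation of Q^{⊗ℓ} (coming from the i-th factor Q, i < ℓ):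
-- the first i coordinates agree and the i-th coordinate is ≤.
RelQ : ∀ {ℓ d} → Fin ℓ → Elem ℓ d → Elem ℓ d → Set
RelQ i (x , _) (y , _) =
  (∀ (j : Fin _) → j Fin.< i → lookup x j ≡ lookup y j) × (lookup x i ℚ.≤ lookup y i)

-- The relation coming from the last factor d = ({0,…,d-1}, ≤):
-- all ℓ rational coordinates agree and the places are ordered by ≤.
RelD : ∀ {ℓ d} → Elem ℓ d → Elem ℓ d → Set
RelD (x , p) (y , q) = (x ≡ y) × (p Fin.≤ q)

IsEmb : ∀ ℓ d → (Elem ℓ d → Elem ℓ d) → Set
IsEmb ℓ d ι =
  (∀ (i : Fin ℓ) (x y : Elem ℓ d) →
     (RelQ i x y → RelQ i (ι x) (ι y)) × (RelQ i (ι x) (ι y) → RelQ i x y))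
  × (∀ (x y : Elem ℓ d) →
     (RelD x y → RelD (ι x) (ι y)) × (RelD (ι x) (ι y) → RelD x y))

-- Monomials over Elem ℓ d are represented by lists, considered up to permutation (_↭_).
Monomial : ℕ → ℕ → Set
Monomial ℓ d = List (Elem ℓ d)

Presentation : ℕ → ℕ → Set
Presentation ℓ d = List (Monomial ℓ d × Monomial ℓ d)

Step : ∀ {ℓ d} → Presentation ℓ d → Monomial ℓ d → Monomial ℓ d → Set
Step {ℓ} {d} T c c' =
  Σ (Elem ℓ d → Elem ℓ d) λ ι → IsEmb ℓ d ι ×
  Σ (Monomial ℓ d × Monomial ℓ d) λ hh → (hh ∈ T) ×
  Σ (Monomial ℓ d) λ g →
    (c ↭ (g ++ map ι (proj₁ hh))) × (c' ↭ (g ++ map ι (proj₂ hh)))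

-- Reflexive-transitive closure →*, on monomials (lists modulo permutation).
Reach : ∀ {ℓ d} → Presentation ℓ d → Monomial ℓ d → Monomial ℓ d → Set
Reach T s t = (s ↭ t) ⊎ Σ _ λ u → Step T s u × Star (Step T) u t

Reversible : ∀ {ℓ d} → Presentation ℓ d → Set
Reversible T = ∀ c c' → Reach T c c' → Reach T c' c

{-# OPTIONS --safe #-}

-- By reversibility, reachability is the congruence generated by T. Fix s and t. The finitely many
-- values occurring in a derivation from s to t embed into ω^{2ℓ}, with two coordinates for each
-- rational one: the values of s and t cut ℚ into intervals, the first coordinate numbers the interval
-- and the second the values inside it. This embedding can be chosen to send s and t to monomials not
-- depending on the derivation, and conversely ω^{2ℓ} embeds into ℚ^ℓ. So it remains to decide the
-- congruences on monomials over ω^{2ℓ} that are generated by finitely many pairs up to embeddings.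
-- There the lexicographic order on monomials is well-founded, unlike over ℚ, and monomials are almost
-- full under divisibility up to embeddings (Higman's lemma, iterated), so Knuth-Bendix (Buchberger)
-- completion terminates and congruent monomials are those with equal normal forms.

module Submission where

open import Defs
open import Algebra.Bundles using (module CommutativeMonoid)
import Algebra.Properties.CommutativeSemigroup as CommutativeSemigroupProperties
open import Algebra.Structures using (IsCommutativeMonoid)
open import Data.Bool using (Bool; true; false; if_then_else_)
open import Data.Empty using (⊥; ⊥-elim)
open import Data.Fin as Fin using (Fin; zero; suc; toℕ)
import Data.Fin.Properties as Fin
open import Data.List using
  (List; []; _∷_; [_]; _++_; map; length; concatMap; filter; foldr; replicate; upTo;
   cartesianProduct; cartesianProductWith)
open import Data.List.Membership.Propositional using (_∈_; find; lose)
open import Data.List.Membership.Propositional.Properties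
open import Data.List.Properties using (map-++; map-∘; map-cong-local; map-id-local; length-map)
open import Data.List.Relation.Binary.Permutation.Propositional
  using (_↭_; ↭-refl; ↭-sym; ↭-trans; ↭-reflexive)
open import Data.List.Relation.Binary.Permutation.Propositional.Properties
  using (++⁺; ++-commutativeMonoid; map⁺; ∈-resp-↭)
open import Data.List.Relation.Unary.All as All using (All; []; _∷_; lookup)
open import Data.List.Relation.Unary.Any using (Any; here; there; any?)
open import Data.Maybe using (Maybe; just; nothing)
open import Data.Nat as ℕ using (ℕ; zero; suc; _≤_; z≤n; s≤s; _⊔_)
import Data.Nat.Induction as ℕ
import Data.Nat.Properties as ℕ
open import Data.Product using (_×_; _,_; proj₁; proj₂; ∃; ∃₂; map₁)
open import Data.Rational as ℚ using (ℚ; 0ℚ; 1ℚ)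
import Data.Rational.Properties as ℚ
open import Data.Sum using (_⊎_; inj₁; inj₂; [_,_]′)
open import Data.Unit using (⊤; tt)
open import Data.Vec using (Vec; []; _∷_; head; tail)
open import Data.Vec.Properties using (≡-dec; ∷-injective)
open import Data.Vec.Relation.Unary.All as VecAll using ([]; _∷_)
open import Function using (_∘_; id)
open import Induction.WellFounded using (WellFounded; Acc; acc)
open import Relation.Binary.Bundles using (Setoid)
open import Relation.Binary.Construct.Closure.ReflexiveTransitive using (Star; ε; _◅_; _◅◅_)
open import Relation.Binary.Definitions using (Tri; tri<; tri≈; tri>; DecidableEquality)
open import Relation.Binary.PropositionalEquality
  using (_≡_; refl; sym; trans; cong; cong₂; subst; subst₂; module ≡-Reasoning)
  renaming (isEquivalence to ≡-isEquivalence)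
open import Relation.Binary.Structures using (IsEquivalence)
open import Relation.Nullary using (Dec; yes; no; ¬_; contradiction)
open import Relation.Nullary.Decidable using (_×-dec_; _⊎-dec_; map′)

-- Almost-full relations and Higman's lemma

-- Two obstacles shape the coding. With a single ω-coordinate for each rational one, the code of a
-- point of `t` would shift with the number of fresh values that a derivation puts below it, and
-- that number is unbounded; a separate coordinate for the interval leaves room for any number of
-- them. In return, the renamings of `sys` respect the comparison at each of the 2ℓ coordinates,
-- whereas embeddings of the rational structure respect only ℓ comparisons. A pair of `T` therefore
-- splits into several rules, one for every admissible way of placing its values in the coded
-- structure. Finitely many placements suffice, because the coordinates of k variables can be
-- compressed to numbers at most k.

data AF {X : Set} (R : X → X → Set) : Set₁ where
  now   : (∀ x y → R x y) → AF R
  -- Once `x` has been met, a sequence also counts as good when a later term lies above `x`. A proof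
  -- is thus a well-founded tree of bad sequences, usable for structural recursion without choice or
  -- excluded middle.
  later : (∀ x → AF (λ y z → R y z ⊎ R x y)) → AF R

af-comap : ∀ {X Y : Set} {R : X → X → Set} {S : Y → Y → Set} (f : Y → X) →
  (∀ x y → R (f x) (f y) → S x y) → AF R → AF S
af-comap f i (now p)   = now λ x y → i x y (p (f x) (f y))
af-comap f i (later p) = later λ x → af-comap f
  (λ y z → [ (λ r → inj₁ (i y z r)) , (λ r → inj₂ (i x y r)) ]′) (p (f x))

af-mono : ∀ {X : Set} {R S : X → X → Set} → (∀ x y → R x y → S x y) → AF R → AF S
af-mono = af-comap (λ x → x)

module _ {X : Set} where

  -- An intuitionistic Ramsey argument in three stages: `A` and `B` are propositions here, unary
  -- predicates in `af-∩₁` and relations in `af-∩₂`. `C` accumulates whatever already makes a pair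
  -- good.
  af-∩₀ : ∀ {P Q C : X → X → Set} {A B : Set} →
    (∀ x y → P x y → C x y ⊎ A) → (∀ x y → Q x y → C x y ⊎ B) →
    AF P → AF Q → AF (λ x y → C x y ⊎ (A × B))
  af-∩₀ i j (now p) q = af-mono
    (λ x y r → [ inj₁ , (λ a → [ inj₁ , (λ b → inj₂ (a , b)) ]′ (j x y r)) ]′ (i x y (p x y))) q
  af-∩₀ i j (later p) q = later λ x → af-mono
    (λ y z → λ { (inj₁ (inj₁ c)) → inj₁ (inj₁ c)
               ; (inj₁ (inj₂ c)) → inj₂ (inj₁ c)
               ; (inj₂ ab) → inj₁ (inj₂ ab) })
    (af-∩₀ (λ y z → λ { (inj₁ r) → [ (λ c → inj₁ (inj₁ c)) , inj₂ ]′ (i y z r)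
                      ; (inj₂ r) → [ (λ c → inj₁ (inj₂ c)) , inj₂ ]′ (i x y r) })
           (λ y z r → [ (λ c → inj₁ (inj₁ c)) , inj₂ ]′ (j y z r))
           (p x) q)

  af-∩₁ : ∀ {P Q C : X → X → Set} {A B : X → Set} →
    (∀ x y → P x y → C x y ⊎ A x) → (∀ x y → Q x y → C x y ⊎ B x) →
    AF P → AF Q → AF (λ x y → C x y ⊎ (A x × B x))
  af-∩₁ i j (now p) q = af-mono
    (λ x y r → [ inj₁ , (λ a → [ inj₁ , (λ b → inj₂ (a , b)) ]′ (j x y r)) ]′ (i x y (p x y))) q
  af-∩₁ i j p@(later _) (now q) = af-mono
    (λ x y r → [ inj₁ , (λ b → [ inj₁ , (λ a → inj₂ (a , b)) ]′ (i x y r)) ]′ (j x y (q x y))) p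
  af-∩₁ {P} {Q} {C} {A} {B} i j p@(later p′) q@(later q′) = later λ x →
    let D : X → X → Set
        D y z = (C y z ⊎ C x y) ⊎ (A y × B y)
        left : AF (λ y z → ((C y z ⊎ C x y) ⊎ A x) ⊎ (A y × B y))
        left = af-∩₁
          (λ y z → λ { (inj₁ r) → [ (λ c → inj₁ (inj₁ (inj₁ c))) , inj₂ ]′ (i y z r)
                     ; (inj₂ r) → inj₁ ([ (λ c → inj₁ (inj₂ c)) , inj₂ ]′ (i x y r)) })
          (λ y z r → [ (λ c → inj₁ (inj₁ (inj₁ c))) , inj₂ ]′ (j y z r))
          (p′ x) q
        right : AF (λ y z → ((C y z ⊎ C x y) ⊎ B x) ⊎ (A y × B y))
        right = af-∩₁
          (λ y z r → [ (λ c → inj₁ (inj₁ (inj₁ c))) , inj₂ ]′ (i y z r))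
          (λ y z → λ { (inj₁ r) → [ (λ c → inj₁ (inj₁ (inj₁ c))) , inj₂ ]′ (j y z r)
                     ; (inj₂ r) → inj₁ ([ (λ c → inj₁ (inj₂ c)) , inj₂ ]′ (j x y r)) })
          p (q′ x)
    in af-mono
      (λ y z → λ { (inj₁ (inj₁ (inj₁ c))) → inj₁ (inj₁ c)
                 ; (inj₁ (inj₁ (inj₂ c))) → inj₂ (inj₁ c)
                 ; (inj₁ (inj₂ ab)) → inj₁ (inj₂ ab)
                 ; (inj₂ ab) → inj₂ (inj₂ ab) })
      (af-∩₀ {C = D} {A = A x} {B = B x}
        (λ y z → λ { (inj₁ (inj₁ c)) → inj₁ (inj₁ c) ; (inj₁ (inj₂ a)) → inj₂ a ; (inj₂ ab) → inj₁ (inj₂ ab) })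
        (λ y z → λ { (inj₁ (inj₁ c)) → inj₁ (inj₁ c) ; (inj₁ (inj₂ a)) → inj₂ a ; (inj₂ ab) → inj₁ (inj₂ ab) })
        left right)

  -- Fixing the first term `x` turns `A` and `B` into the unary predicates `A x` and `B x`. The
  -- induction yields `left` and `right`, each weakened by one of them, and these are joined one
  -- arity lower by `af-∩₁`, which falls back on `af-∩₀` in the same way.
  af-∩₂ : ∀ {P Q C A B : X → X → Set} →
    (∀ x y → P x y → C x y ⊎ A x y) → (∀ x y → Q x y → C x y ⊎ B x y) →
    AF P → AF Q → AF (λ x y → C x y ⊎ (A x y × B x y))
  af-∩₂ i j (now p) q = af-mono
    (λ x y r → [ inj₁ , (λ a → [ inj₁ , (λ b → inj₂ (a , b)) ]′ (j x y r)) ]′ (i x y (p x y))) q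
  af-∩₂ i j p@(later _) (now q) = af-mono
    (λ x y r → [ inj₁ , (λ b → [ inj₁ , (λ a → inj₂ (a , b)) ]′ (i x y r)) ]′ (j x y (q x y))) p
  af-∩₂ {P} {Q} {C} {A} {B} i j p@(later p′) q@(later q′) = later λ x →
    let D : X → X → Set
        D y z = (C y z ⊎ C x y) ⊎ (A y z × B y z)
        left : AF (λ y z → ((C y z ⊎ C x y) ⊎ A x y) ⊎ (A y z × B y z))
        left = af-∩₂
          (λ y z → λ { (inj₁ r) → [ (λ c → inj₁ (inj₁ (inj₁ c))) , inj₂ ]′ (i y z r)
                     ; (inj₂ r) → inj₁ ([ (λ c → inj₁ (inj₂ c)) , inj₂ ]′ (i x y r)) })
          (λ y z r → [ (λ c → inj₁ (inj₁ (inj₁ c))) , inj₂ ]′ (j y z r))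
          (p′ x) q
        right : AF (λ y z → ((C y z ⊎ C x y) ⊎ B x y) ⊎ (A y z × B y z))
        right = af-∩₂
          (λ y z r → [ (λ c → inj₁ (inj₁ (inj₁ c))) , inj₂ ]′ (i y z r))
          (λ y z → λ { (inj₁ r) → [ (λ c → inj₁ (inj₁ (inj₁ c))) , inj₂ ]′ (j y z r)
                     ; (inj₂ r) → inj₁ ([ (λ c → inj₁ (inj₂ c)) , inj₂ ]′ (j x y r)) })
          p (q′ x)
    in af-mono
      (λ y z → λ { (inj₁ (inj₁ (inj₁ c))) → inj₁ (inj₁ c)
                 ; (inj₁ (inj₁ (inj₂ c))) → inj₂ (inj₁ c)
                 ; (inj₁ (inj₂ ab)) → inj₁ (inj₂ ab)
                 ; (inj₂ ab) → inj₂ (inj₂ ab) })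
      (af-∩₁ {C = D} {A = A x} {B = B x}
        (λ y z → λ { (inj₁ (inj₁ c)) → inj₁ (inj₁ c) ; (inj₁ (inj₂ a)) → inj₂ a ; (inj₂ ab) → inj₁ (inj₂ ab) })
        (λ y z → λ { (inj₁ (inj₁ c)) → inj₁ (inj₁ c) ; (inj₁ (inj₂ a)) → inj₂ a ; (inj₂ ab) → inj₁ (inj₂ ab) })
        left right)

  af-∩ : ∀ {A B : X → X → Set} → AF A → AF B → AF (λ x y → A x y × B x y)
  af-∩ p q = af-mono (λ x y → λ { (inj₂ ab) → ab })
    (af-∩₂ {C = λ _ _ → ⊥} (λ _ _ → inj₂) (λ _ _ → inj₂) p q)

-- A first term `x` bounds every descent: the next term is either above it or leaves a smaller
-- bound, hence the induction in `go`.
af-≤ : AF _≤_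
af-≤ = later go
  where
  go : ∀ x → AF (λ y z → y ≤ z ⊎ x ≤ y)
  go zero    = now λ _ _ → inj₂ z≤n
  go (suc x) = later λ x′ → af-mono
    (λ y z → λ { (inj₁ p) → inj₁ (inj₁ p) ; (inj₂ p) → lemma y z x′ p }) (go x)
    where
    lemma : ∀ y z x′ → x ≤ y → (y ≤ z ⊎ suc x ≤ y) ⊎ (x′ ≤ y ⊎ suc x ≤ x′)
    lemma y z x′ p with x′ ℕ.≤? y | suc x ℕ.≤? x′
    ... | yes q | _     = inj₂ (inj₁ q)
    ... | no _  | yes q = inj₂ (inj₂ q)
    ... | no a  | no b  = ⊥-elim (b (ℕ.≤-trans (s≤s p) (ℕ.≰⇒> a)))

af-bool : AF {Bool} _≡_
af-bool = later λ a → later λ b → now (λ c d → f a b c d)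
  where
  f : ∀ (a b c d : Bool) → (c ≡ d ⊎ a ≡ c) ⊎ (b ≡ c ⊎ a ≡ b)
  f false false _     _ = inj₂ (inj₂ refl)
  f true  true  _     _ = inj₂ (inj₂ refl)
  f false true  false _ = inj₁ (inj₂ refl)
  f false true  true  _ = inj₂ (inj₁ refl)
  f true  false false _ = inj₂ (inj₁ refl)
  f true  false true  _ = inj₁ (inj₂ refl)

data Emb {A : Set} (R : A → A → Set) : List A → List A → Set where
  []   : ∀ {ys} → Emb R [] ys
  skip : ∀ {xs y ys} → Emb R xs ys → Emb R xs (y ∷ ys)
  keep : ∀ {x xs y ys} → R x y → Emb R xs ys → Emb R (x ∷ xs) (y ∷ ys)

module _ {A : Set} {R : A → A → Set} where

  emb-++ : ∀ {xs ys xs′ ys′} → Emb R xs ys → Emb R xs′ ys′ → Emb R (xs ++ xs′) (ys ++ ys′)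
  emb-++ {ys = []}     []         q = q
  emb-++ {ys = y ∷ ys} []         q = skip (emb-++ {ys = ys} [] q)
  emb-++ (skip p)   q = skip (emb-++ p q)
  emb-++ (keep r p) q = keep r (emb-++ p q)

  emb-avoid : ∀ {x v w} → All (λ y → ¬ R x y) v → Emb (λ y z → R y z ⊎ R x y) v w → Emb R v w
  emb-avoid a        []                = []
  emb-avoid a        (skip p)          = skip (emb-avoid a p)
  emb-avoid (_ ∷ a)  (keep (inj₁ r) p) = keep r (emb-avoid a p)
  emb-avoid (na ∷ a) (keep (inj₂ r) p) = ⊥-elim (na r)

  emb-full : (∀ x y → R x y) → ∀ xs ys → length xs ≤ length ys → Emb R xs ys
  emb-full f []       ys       p       = []
  emb-full f (x ∷ xs) (y ∷ ys) (s≤s p) = keep (f x y) (emb-full f xs ys p)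

  -- Splits v at its first letter above x; if there is none (flag false), a and v₁ are dummies.
  record Split (x : A) (v : List A) : Set where
    constructor split
    field
      flag  : Bool
      v₀    : List A
      a     : A
      v₁    : List A
      avoid : All (λ y → ¬ R x y) v₀
      spec  : if flag then (R x a × v ≡ v₀ ++ a ∷ v₁) else v ≡ v₀

  split-at : (∀ x y → Dec (R x y)) → ∀ x v → Split x v
  split-at R? x [] = split false [] x [] [] refl
  split-at R? x (y ∷ v) with R? x y
  ... | yes r = split true [] y v [] (r , refl)
  ... | no ¬r with split-at R? x v
  ...   | split false v₀ a v₁ av e       = split false (y ∷ v₀) a v₁ (¬r ∷ av) (cong (y ∷_) e)
  ...   | split true  v₀ a v₁ av (r , e) = split true (y ∷ v₀) a v₁ (¬r ∷ av) (r , cong (y ∷_) e)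

-- Words avoiding x ∷ u are either words over letters avoiding x, or such a word followed by a
-- letter and a word avoiding u.
higman : ∀ {A : Set} {R : A → A → Set} → (∀ x y → Dec (R x y)) → AF R → AF (Emb R)
higman R? (now p) = af-comap length (λ xs ys → emb-full p xs ys) af-≤
higman {A} {R} R? r@(later p) = later go
  where
  open Split
  go : ∀ u → AF (λ v w → Emb R v w ⊎ Emb R u v)
  go [] = now λ _ _ → inj₂ []
  go (x ∷ u) = af-mono combine (af-∩ (af-∩ flags prefixes) (af-∩ letters suffixes))
    where
    sp : ∀ v → Split {R = R} x v
    sp = split-at R? x
    flags : AF (λ v w → flag (sp v) ≡ flag (sp w))
    flags = af-comap (λ v → flag (sp v)) (λ _ _ e → e) af-bool
    prefixes : AF (λ v w → Emb (λ y z → R y z ⊎ R x y) (v₀ (sp v)) (v₀ (sp w)))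
    -- The outer recursion is on the almost-full proof for letters: it descends to `p x`, whose
    -- weaker relation `emb-avoid` brings back to `R` on letters avoiding `x`. The inner recursion,
    -- in `suffixes`, is on `u`.
    prefixes = af-comap (λ v → v₀ (sp v)) (λ _ _ e → e)
      (higman (λ y z → R? y z ⊎-dec R? x y) (p x))
    letters : AF (λ v w → R (a (sp v)) (a (sp w)))
    letters = af-comap (λ v → a (sp v)) (λ _ _ e → e) r
    suffixes : AF (λ v w → Emb R (v₁ (sp v)) (v₁ (sp w)) ⊎ Emb R u (v₁ (sp v)))
    suffixes = af-comap (λ v → v₁ (sp v)) (λ _ _ e → e) (go u)
    combine : ∀ v w →
      (flag (sp v) ≡ flag (sp w) × Emb (λ y z → R y z ⊎ R x y) (v₀ (sp v)) (v₀ (sp w))) ×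
      (R (a (sp v)) (a (sp w)) × (Emb R (v₁ (sp v)) (v₁ (sp w)) ⊎ Emb R u (v₁ (sp v)))) →
      Emb R v w ⊎ Emb R (x ∷ u) v
    combine v w ((fe , pe) , (le , se)) with sp v | sp w
    combine v w ((refl , pe) , _) | split false _ _ _ av refl | split false _ _ _ _ refl =
      inj₁ (emb-avoid av pe)
    combine v w ((refl , pe) , (le , inj₁ se)) | split true _ _ _ av (_ , refl) | split true _ _ _ _ (_ , refl) =
      inj₁ (emb-++ (emb-avoid av pe) (keep le se))
    combine v w ((refl , pe) , (le , inj₂ se)) | split true v₀ _ _ av (xa , refl) | split true _ _ _ _ _ =
      inj₂ (emb-++ {ys = v₀} [] (keep xa se))

-- Monomials with an ordering and embeddings

-- Both the interface of completion and the induction hypothesis for adding a coordinate: `base` and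
-- `lift` establish all fields, so monomials over powers of ω arise by iteration.
record MonomialSystem : Set₁ where
  infixl 6 _+_ _∸_
  infix  4 _≈_ _<_ _≼_
  field
    X    : Set
    _≈_  : X → X → Set
    0#   : X
    _+_  : X → X → X
    isCommutativeMonoid : IsCommutativeMonoid _≈_ _+_ 0#
    _≟_  : ∀ x y → Dec (x ≈ y)

    -- Truncated subtraction of exponents: `(y ∸ x) + x` is the least common multiple of `x` and
    -- `y`. By `∸-minimal` every common multiple is a multiple of it, with cofactor `g ∸ (y ∸ x)`.
    _∸_       : X → X → X
    ∸-cong    : ∀ {x x′ y y′} → x ≈ x′ → y ≈ y′ → x ∸ y ≈ x′ ∸ y′
    0∸0       : 0# ∸ 0# ≈ 0#
    ∸-balance : ∀ x y → (y ∸ x) + x ≈ (x ∸ y) + y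
    ∸-minimal : ∀ {g g′ x y} → g + x ≈ g′ + y →
      g ≈ (g ∸ (y ∸ x)) + (y ∸ x) × g′ ≈ (g ∸ (y ∸ x)) + (x ∸ y)

    _<_     : X → X → Set
    <-resp  : ∀ {x x′ y y′} → x ≈ x′ → y ≈ y′ → x < y → x′ < y′
    <-wf    : WellFounded _<_
    compare : ∀ x y → x < y ⊎ x ≈ y ⊎ y < x
    ≮0      : ∀ {x} → ¬ (x < 0#)
    +-mono-< : ∀ g {x y} → x < y → g + x < g + y

    E        : Set
    app      : E → X → X
    idE      : E
    _∘E_     : E → E → E
    app-cong : ∀ e {x y} → x ≈ y → app e x ≈ app e y
    app-0    : ∀ e → app e 0# ≈ 0#
    app-+    : ∀ e x y → app e (x + y) ≈ app e x + app e y
    -- This reflects that renamings are injective on variables. With `app-+` it makes them commute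
    -- with least common multiples.
    app-∸    : ∀ e x y → app e (x ∸ y) ≈ app e x ∸ app e y
    app-<    : ∀ e {x y} → x < y → app e x < app e y
    app-id   : ∀ x → app idE x ≈ x
    app-∘    : ∀ e f x → app (e ∘E f) x ≈ app e (app f x)

  _≼_ : X → X → Set
  h ≼ s = ∃₂ λ g e → s ≈ g + app e h

  field
    _≼?_  : ∀ h s → Dec (h ≼ s)
    ≼-af  : AF _≼_
    ≼0⇒≈0 : ∀ {h} → h ≼ 0# → h ≈ 0#

    -- A monomial may have variables beyond those of the left-hand side of a rule, and two embeddings
    -- of infinitely many variables have infinitely many overlaps; only those of bounded size count.
    size : X → ℕ
    overlaps : ℕ → List (E × E)
    overlaps-complete : ∀ N e e′ → ∃₂ λ c c′ → (c , c′) ∈ overlaps N × ∃ λ f →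
      (∀ x → size x ℕ.≤ N → app e x ≈ app f (app c x)) ×
      (∀ x → size x ℕ.≤ N → app e′ x ≈ app f (app c′ x))

  open IsCommutativeMonoid isCommutativeMonoid public
    using (isEquivalence; assoc; comm; identityˡ; identityʳ; ∙-cong)
  open IsEquivalence isEquivalence public
    renaming (refl to ≈-refl; sym to ≈-sym; trans to ≈-trans; reflexive to ≈-reflexive)

  setoid : Setoid _ _
  setoid = record { isEquivalence = isEquivalence }

-- Monomials over the places alone

module Base where

  infixl 6 _+_ _∸_
  infix  4 _<_ _≼_

  private variable d : ℕ

  0# : Vec ℕ d
  0# {zero}  = []
  0# {suc d} = 0 ∷ 0#

  _+_ _∸_ : Vec ℕ d → Vec ℕ d → Vec ℕ d
  []      + []      = []
  (m ∷ x) + (n ∷ y) = m ℕ.+ n ∷ x + y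
  []      ∸ []      = []
  (m ∷ x) ∸ (n ∷ y) = m ℕ.∸ n ∷ x ∸ y

  data _<_ : Vec ℕ d → Vec ℕ d → Set where
    tail< : ∀ {m n} {x y : Vec ℕ d} → x < y → (m ∷ x) < (n ∷ y)
    head< : ∀ {m n} {x : Vec ℕ d} → m ℕ.< n → (m ∷ x) < (n ∷ x)

  _≼_ : Vec ℕ d → Vec ℕ d → Set
  h ≼ s = ∃₂ λ g (_ : ⊤) → s ≡ g + h

  +-assoc : (x y z : Vec ℕ d) → (x + y) + z ≡ x + (y + z)
  +-assoc [] [] [] = refl
  +-assoc (m ∷ x) (n ∷ y) (o ∷ z) = cong₂ _∷_ (ℕ.+-assoc m n o) (+-assoc x y z)

  +-comm : (x y : Vec ℕ d) → x + y ≡ y + x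
  +-comm [] [] = refl
  +-comm (m ∷ x) (n ∷ y) = cong₂ _∷_ (ℕ.+-comm m n) (+-comm x y)

  +-identityˡ : (x : Vec ℕ d) → 0# + x ≡ x
  +-identityˡ [] = refl
  +-identityˡ (m ∷ x) = cong (m ∷_) (+-identityˡ x)

  0∸0 : 0# ∸ 0# ≡ 0# {d}
  0∸0 {zero}  = refl
  0∸0 {suc d} = cong (0 ∷_) 0∸0

  ∸-balance-ℕ : ∀ m n → (n ℕ.∸ m) ℕ.+ m ≡ (m ℕ.∸ n) ℕ.+ n
  ∸-balance-ℕ zero    n       = trans (ℕ.+-identityʳ n) (cong (ℕ._+ n) (sym (ℕ.0∸n≡0 n)))
  ∸-balance-ℕ (suc m) zero    = sym (ℕ.+-identityʳ (suc m))
  ∸-balance-ℕ (suc m) (suc n) = trans (ℕ.+-suc (n ℕ.∸ m) m)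
    (trans (cong suc (∸-balance-ℕ m n)) (sym (ℕ.+-suc (m ℕ.∸ n) n)))

  ∸-balance : (x y : Vec ℕ d) → (y ∸ x) + x ≡ (x ∸ y) + y
  ∸-balance [] [] = refl
  ∸-balance (m ∷ x) (n ∷ y) = cong₂ _∷_ (∸-balance-ℕ m n) (∸-balance x y)

  ∸-minimal-ℕ : ∀ g g′ m n → g ℕ.+ m ≡ g′ ℕ.+ n →
    g ≡ (g ℕ.∸ (n ℕ.∸ m)) ℕ.+ (n ℕ.∸ m) × g′ ≡ (g ℕ.∸ (n ℕ.∸ m)) ℕ.+ (m ℕ.∸ n)
  ∸-minimal-ℕ g g′ zero zero e = sym (ℕ.+-identityʳ g) , sym (trans (ℕ.+-identityʳ g)
    (trans (sym (ℕ.+-identityʳ g)) (trans e (ℕ.+-identityʳ g′))))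
  ∸-minimal-ℕ g g′ zero (suc n) e = sym (ℕ.m∸n+n≡m le) ,
    trans (sym (ℕ.m+n∸n≡m g′ (suc n))) (trans (cong (ℕ._∸ suc n) (sym e′)) (sym (ℕ.+-identityʳ _)))
    where
    e′ : g ≡ g′ ℕ.+ suc n
    e′ = trans (sym (ℕ.+-identityʳ g)) e
    le : suc n ℕ.≤ g
    le = subst (suc n ℕ.≤_) (sym e′) (ℕ.m≤n+m (suc n) g′)
  ∸-minimal-ℕ g g′ (suc m) zero e =
    sym (ℕ.+-identityʳ g) , trans (sym (ℕ.+-identityʳ g′)) (sym e)
  ∸-minimal-ℕ g g′ (suc m) (suc n) e = ∸-minimal-ℕ g g′ m n
    (ℕ.suc-injective (trans (sym (ℕ.+-suc g m)) (trans e (ℕ.+-suc g′ n))))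

  ∸-minimal : {g g′ x y : Vec ℕ d} → g + x ≡ g′ + y →
    g ≡ (g ∸ (y ∸ x)) + (y ∸ x) × g′ ≡ (g ∸ (y ∸ x)) + (x ∸ y)
  ∸-minimal {g = []} {[]} {[]} {[]} e = refl , refl
  ∸-minimal {g = k ∷ g} {k′ ∷ g′} {m ∷ x} {n ∷ y} e =
    let e₁ , e₂ = ∷-injective e
        p₁ , p₂ = ∸-minimal-ℕ k k′ m n e₁
        q₁ , q₂ = ∸-minimal {g = g} {g′} {x} {y} e₂
    in cong₂ _∷_ p₁ q₁ , cong₂ _∷_ p₂ q₂

  <-wf : WellFounded (_<_ {d})
  <-wf [] = acc λ ()
  <-wf (n ∷ y) = go (<-wf y) (ℕ.<-wellFounded n)
    where
    go : ∀ {d} {y : Vec ℕ d} {n} → Acc _<_ y → Acc ℕ._<_ n → Acc _<_ (n ∷ y)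
    below : ∀ {d} {y : Vec ℕ d} {n z} → Acc _<_ y → Acc ℕ._<_ n → z < (n ∷ y) → Acc _<_ z
    go a b = acc (below a b)
    below (acc r) _ (tail< p) = go (r p) (ℕ.<-wellFounded _)
    below a (acc q) (head< p) = go a (q p)

  compare : (x y : Vec ℕ d) → x < y ⊎ x ≡ y ⊎ y < x
  compare [] [] = inj₂ (inj₁ refl)
  compare (m ∷ x) (n ∷ y) with compare x y
  ... | inj₁ p = inj₁ (tail< p)
  ... | inj₂ (inj₂ p) = inj₂ (inj₂ (tail< p))
  ... | inj₂ (inj₁ refl) with ℕ.<-cmp m n
  ...   | tri< p _ _ = inj₁ (head< p)
  ...   | tri≈ _ refl _ = inj₂ (inj₁ refl)
  ...   | tri> _ _ p = inj₂ (inj₂ (head< p))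

  ≮0 : {x : Vec ℕ d} → ¬ (x < 0#)
  ≮0 {suc d} (tail< p) = ≮0 p

  +-mono-< : (g : Vec ℕ d) {x y : Vec ℕ d} → x < y → g + x < g + y
  +-mono-< (k ∷ g) (tail< p) = tail< (+-mono-< g p)
  +-mono-< (k ∷ g) (head< p) = head< (ℕ.+-monoʳ-< k p)

  ≼? : (h s : Vec ℕ d) → Dec (h ≼ s)
  ≼? [] [] = yes ([] , tt , refl)
  ≼? (m ∷ h) (n ∷ s) = map′
    (λ { (p , (g , _ , e)) → n ℕ.∸ m ∷ g , tt , cong₂ _∷_ (sym (ℕ.m∸n+n≡m p)) e })
    (λ { (k ∷ g , _ , e) → subst (m ℕ.≤_) (sym (proj₁ (∷-injective e))) (ℕ.m≤n+m m k)
                         , g , tt , proj₂ (∷-injective e) })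
    ((m ℕ.≤? n) ×-dec ≼? h s)

  ≼-af : AF (_≼_ {d})
  ≼-af {zero} = now λ { [] [] → [] , tt , refl }
  ≼-af {suc d} = af-mono
    (λ { (m ∷ h) (n ∷ s) (p , (g , _ , e)) → n ℕ.∸ m ∷ g , tt , cong₂ _∷_ (sym (ℕ.m∸n+n≡m p)) e })
    (af-∩ (af-comap {S = λ x y → head x ℕ.≤ head y} head (λ _ _ p → p) af-≤)
          (af-comap {S = λ x y → tail x ≼ tail y} tail (λ _ _ p → p) ≼-af))

  ≼0⇒≈0 : {h : Vec ℕ d} → h ≼ 0# → h ≡ 0#
  ≼0⇒≈0 {h = []} _ = refl
  ≼0⇒≈0 {h = m ∷ h} (k ∷ g , _ , e) = cong₂ _∷_
    (ℕ.m+n≡0⇒n≡0 k (sym (proj₁ (∷-injective e)))) (≼0⇒≈0 (g , tt , proj₂ (∷-injective e)))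

base : ℕ → MonomialSystem
base d = record
  { X = Vec ℕ d ; _≈_ = _≡_ ; 0# = 0# ; _+_ = _+_
  ; isCommutativeMonoid = record
    { isMonoid = record
      { isSemigroup = record
        { isMagma = record
          { isEquivalence = ≡-isEquivalence
          ; ∙-cong = cong₂ _+_ }
        ; assoc = +-assoc }
      ; identity = +-identityˡ , λ x → trans (+-comm x 0#) (+-identityˡ x) }
    ; comm = +-comm }
  ; _≟_ = ≡-dec ℕ._≟_
  ; _∸_ = _∸_ ; ∸-cong = cong₂ _∸_ ; 0∸0 = 0∸0 ; ∸-balance = ∸-balance
  ; ∸-minimal = λ {g} {g′} {x} {y} → ∸-minimal {g = g} {g′} {x} {y}
  ; _<_ = _<_ ; <-resp = λ { refl refl p → p } ; <-wf = <-wf ; compare = compare ; ≮0 = ≮0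
  ; +-mono-< = +-mono-<
  -- Embeddings fix the places (`emb⇒place`), so the identity is the only renaming at this level.
  ; E = ⊤ ; app = λ _ x → x ; idE = tt ; _∘E_ = λ _ _ → tt
  ; app-cong = λ _ p → p ; app-0 = λ _ → refl ; app-+ = λ _ _ _ → refl ; app-∸ = λ _ _ _ → refl
  ; app-< = λ _ p → p ; app-id = λ _ → refl ; app-∘ = λ _ _ _ → refl
  ; _≼?_ = ≼? ; ≼-af = ≼-af ; ≼0⇒≈0 = ≼0⇒≈0
  ; size = λ _ → 0 ; overlaps = λ _ → (tt , tt) ∷ []
  ; overlaps-complete = λ _ _ _ → tt , tt , here refl , tt , (λ _ _ → refl) , (λ _ _ → refl)
  }
  where open Base

-- Adding a leading ω-coordinate: finite sequences of monomials

module Lift (S : MonomialSystem) where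
  open MonomialSystem S

  open import Relation.Binary.Reasoning.Setoid setoid

  -- A list stands for a finitely supported function on ℕ: entry `n` collects the variables with
  -- leading coordinate `n`, that coordinate being dropped. Trailing `0#` are therefore immaterial,
  -- and laws are checked entrywise.
  at : List X → ℕ → X
  at []       n       = 0#
  at (x ∷ xs) zero    = x
  at (x ∷ xs) (suc n) = at xs n

  infix 4 _≈ᴸ_ _<ᴸ_ _≼ᴸ_

  record _≈ᴸ_ (xs ys : List X) : Set where
    constructor pointwise
    field at-≈ : ∀ n → at xs n ≈ at ys n
  open _≈ᴸ_ public

  zip₀ : (X → X → X) → List X → List X → List X
  zip₀ f []       []       = []
  zip₀ f []       (y ∷ ys) = f 0# y ∷ zip₀ f [] ys
  zip₀ f (x ∷ xs) []       = f x 0# ∷ zip₀ f xs []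
  zip₀ f (x ∷ xs) (y ∷ ys) = f x y ∷ zip₀ f xs ys

  at-zip₀ : ∀ f → f 0# 0# ≈ 0# → ∀ xs ys n → at (zip₀ f xs ys) n ≈ f (at xs n) (at ys n)
  at-zip₀ f z []       []       n       = ≈-sym z
  at-zip₀ f z []       (y ∷ ys) zero    = ≈-refl
  at-zip₀ f z []       (y ∷ ys) (suc n) = at-zip₀ f z [] ys n
  at-zip₀ f z (x ∷ xs) []       zero    = ≈-refl
  at-zip₀ f z (x ∷ xs) []       (suc n) = at-zip₀ f z xs [] n
  at-zip₀ f z (x ∷ xs) (y ∷ ys) zero    = ≈-refl
  at-zip₀ f z (x ∷ xs) (y ∷ ys) (suc n) = at-zip₀ f z xs ys n

  infixl 6 _+ᴸ_ _∸ᴸ_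

  _+ᴸ_ _∸ᴸ_ : List X → List X → List X
  _+ᴸ_ = zip₀ _+_
  _∸ᴸ_ = zip₀ _∸_

  at-+ : ∀ xs ys n → at (xs +ᴸ ys) n ≈ at xs n + at ys n
  at-+ = at-zip₀ _+_ (identityˡ 0#)

  at-∸ : ∀ xs ys n → at (xs ∸ᴸ ys) n ≈ at xs n ∸ at ys n
  at-∸ = at-zip₀ _∸_ 0∸0

  +ᴸ-cong : ∀ {xs xs′ ys ys′} → xs ≈ᴸ xs′ → ys ≈ᴸ ys′ → xs +ᴸ ys ≈ᴸ xs′ +ᴸ ys′
  +ᴸ-cong {xs} {xs′} {ys} {ys′} p q = pointwise λ n →
    ≈-trans (at-+ xs ys n) (≈-trans (∙-cong (at-≈ p n) (at-≈ q n)) (≈-sym (at-+ xs′ ys′ n)))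

  ∸ᴸ-cong : ∀ {xs xs′ ys ys′} → xs ≈ᴸ xs′ → ys ≈ᴸ ys′ → xs ∸ᴸ ys ≈ᴸ xs′ ∸ᴸ ys′
  ∸ᴸ-cong {xs} {xs′} {ys} {ys′} p q = pointwise λ n →
    ≈-trans (at-∸ xs ys n) (≈-trans (∸-cong (at-≈ p n) (at-≈ q n)) (≈-sym (at-∸ xs′ ys′ n)))

  +ᴸ-assoc : ∀ xs ys zs → (xs +ᴸ ys) +ᴸ zs ≈ᴸ xs +ᴸ (ys +ᴸ zs)
  +ᴸ-assoc xs ys zs = pointwise λ n → begin
    at ((xs +ᴸ ys) +ᴸ zs) n        ≈⟨ at-+ (xs +ᴸ ys) zs n ⟩
    at (xs +ᴸ ys) n + at zs n      ≈⟨ ∙-cong (at-+ xs ys n) ≈-refl ⟩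
    (at xs n + at ys n) + at zs n  ≈⟨ assoc _ _ _ ⟩
    at xs n + (at ys n + at zs n)  ≈⟨ ∙-cong ≈-refl (at-+ ys zs n) ⟨
    at xs n + at (ys +ᴸ zs) n      ≈⟨ at-+ xs (ys +ᴸ zs) n ⟨
    at (xs +ᴸ (ys +ᴸ zs)) n        ∎

  +ᴸ-comm : ∀ xs ys → xs +ᴸ ys ≈ᴸ ys +ᴸ xs
  +ᴸ-comm xs ys = pointwise λ n →
    ≈-trans (at-+ xs ys n) (≈-trans (comm _ _) (≈-sym (at-+ ys xs n)))

  +ᴸ-identityˡ : ∀ xs → [] +ᴸ xs ≈ᴸ xs
  +ᴸ-identityˡ xs = pointwise λ n → ≈-trans (at-+ [] xs n) (identityˡ _)

  +ᴸ-identityʳ : ∀ xs → xs +ᴸ [] ≈ᴸ xs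
  +ᴸ-identityʳ xs = pointwise λ n → ≈-trans (at-+ xs [] n) (identityʳ _)

  at-∸+ : ∀ xs ys zs n → at ((xs ∸ᴸ ys) +ᴸ zs) n ≈ (at xs n ∸ at ys n) + at zs n
  at-∸+ xs ys zs n = ≈-trans (at-+ (xs ∸ᴸ ys) zs n) (∙-cong (at-∸ xs ys n) ≈-refl)

  ∸ᴸ-balance : ∀ xs ys → (ys ∸ᴸ xs) +ᴸ xs ≈ᴸ (xs ∸ᴸ ys) +ᴸ ys
  ∸ᴸ-balance xs ys = pointwise λ n →
    ≈-trans (at-∸+ ys xs xs n) (≈-trans (∸-balance _ _) (≈-sym (at-∸+ xs ys ys n)))

  ∸ᴸ-minimal : ∀ {g g′ xs ys} → g +ᴸ xs ≈ᴸ g′ +ᴸ ys →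
    g ≈ᴸ (g ∸ᴸ (ys ∸ᴸ xs)) +ᴸ (ys ∸ᴸ xs) × g′ ≈ᴸ (g ∸ᴸ (ys ∸ᴸ xs)) +ᴸ (xs ∸ᴸ ys)
  ∸ᴸ-minimal {g} {g′} {xs} {ys} e =
    pointwise (λ n → ≈-trans (proj₁ (min n)) (≈-sym (expand ys xs n))) ,
    pointwise (λ n → ≈-trans (proj₂ (min n)) (≈-sym (expand xs ys n)))
    where
    min = λ n → ∸-minimal
      (≈-trans (≈-sym (at-+ g xs n)) (≈-trans (at-≈ e n) (at-+ g′ ys n)))
    expand : ∀ us vs n → at ((g ∸ᴸ (ys ∸ᴸ xs)) +ᴸ (us ∸ᴸ vs)) n ≈
      (at g n ∸ (at ys n ∸ at xs n)) + (at us n ∸ at vs n)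
    expand us vs n = ≈-trans (at-∸+ g (ys ∸ᴸ xs) (us ∸ᴸ vs) n)
      (∙-cong (∸-cong ≈-refl (at-∸ ys xs n)) (at-∸ us vs n))

  ∷-≈ : ∀ {x y xs ys} → x ≈ y → xs ≈ᴸ ys → x ∷ xs ≈ᴸ y ∷ ys
  ∷-≈ p q = pointwise λ { zero → p ; (suc n) → at-≈ q n }

  []-≈ : ∀ {y ys} → 0# ≈ y → [] ≈ᴸ ys → [] ≈ᴸ y ∷ ys
  []-≈ p q = pointwise λ { zero → p ; (suc n) → at-≈ q n }

  ≈ᴸ-sym : ∀ {xs ys} → xs ≈ᴸ ys → ys ≈ᴸ xs
  ≈ᴸ-sym p = pointwise λ n → ≈-sym (at-≈ p n)

  ≈ᴸ-trans : ∀ {xs ys zs} → xs ≈ᴸ ys → ys ≈ᴸ zs → xs ≈ᴸ zs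
  ≈ᴸ-trans p q = pointwise λ n → ≈-trans (at-≈ p n) (at-≈ q n)

  ≈ᴸ-refl : ∀ {xs} → xs ≈ᴸ xs
  ≈ᴸ-refl = pointwise λ n → ≈-refl

  _≟ᴸ_ : ∀ xs ys → Dec (xs ≈ᴸ ys)
  []       ≟ᴸ []       = yes ≈ᴸ-refl
  []       ≟ᴸ (y ∷ ys) = map′ (λ { (p , q) → []-≈ p q })
    (λ e → at-≈ e 0 , pointwise (at-≈ e ∘ suc)) ((0# ≟ y) ×-dec ([] ≟ᴸ ys))
  (x ∷ xs) ≟ᴸ []       = map′ (λ { (p , q) → ≈ᴸ-sym ([]-≈ (≈-sym p) (≈ᴸ-sym q)) })
    (λ e → at-≈ e 0 , pointwise (at-≈ e ∘ suc)) ((x ≟ 0#) ×-dec (xs ≟ᴸ []))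
  (x ∷ xs) ≟ᴸ (y ∷ ys) = map′ (λ { (p , q) → ∷-≈ p q })
    (λ e → at-≈ e 0 , pointwise (at-≈ e ∘ suc)) ((x ≟ y) ×-dec (xs ≟ᴸ ys))

  -- Decided at the last difference: lists of unbounded length are not well-founded under comparison
  -- at the first one.
  record _<ᴸ_ (xs ys : List X) : Set where
    constructor less
    field
      index : ℕ
      below : at xs index < at ys index
      above : ∀ k → index ℕ.< k → at xs k ≈ at ys k

  <ᴸ-resp : ∀ {xs xs′ ys ys′} → xs ≈ᴸ xs′ → ys ≈ᴸ ys′ → xs <ᴸ ys → xs′ <ᴸ ys′
  <ᴸ-resp p q (less n b a) = less n (<-resp (at-≈ p n) (at-≈ q n) b)
    (λ k l → ≈-trans (≈-sym (at-≈ p k)) (≈-trans (a k l) (at-≈ q k)))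

  ≮0ᴸ : ∀ {xs} → ¬ (xs <ᴸ [])
  ≮0ᴸ (less n b _) = ≮0 b

  tail₀ : List X → List X
  tail₀ []       = []
  tail₀ (x ∷ xs) = xs

  at-tail₀ : ∀ xs n → at (tail₀ xs) n ≡ at xs (suc n)
  at-tail₀ []       n = refl
  at-tail₀ (x ∷ xs) n = refl

  -- Lexicographic induction, on the tail first and on the head second, since a difference in the
  -- tail outweighs the head.
  <ᴸ-wf : WellFounded _<ᴸ_
  <ᴸ-wf []       = acc λ p → ⊥-elim (≮0ᴸ p)
  <ᴸ-wf (y ∷ ys) = go (<ᴸ-wf ys) (<-wf y)
    where
    go : ∀ {y ys} → Acc _<ᴸ_ ys → Acc _<_ y → Acc _<ᴸ_ (y ∷ ys)
    low : ∀ {y ys zs} → Acc _<ᴸ_ ys → Acc _<_ y → zs <ᴸ (y ∷ ys) → Acc _<ᴸ_ zs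
    go a b = acc (low a b)
    low {zs = zs} (acc r) b (less (suc n) p q) =
      -- `zs` is only `_≈ᴸ_` to its head followed by its tail, so its accessibility is obtained
      -- through its predecessors, which `<ᴸ-resp` transfers.
      acc λ l → low′ (<ᴸ-resp ≈ᴸ-refl (≈zs zs) l)
      where
      ≈zs : ∀ zs → zs ≈ᴸ at zs 0 ∷ tail₀ zs
      ≈zs zs = pointwise λ { zero → ≈-refl ; (suc n) → ≈-reflexive (sym (at-tail₀ zs n)) }
      low′ : ∀ {us} → us <ᴸ (at zs 0 ∷ tail₀ zs) → Acc _<ᴸ_ us
      low′ = low (r (less n (<-resp (≈-reflexive (sym (at-tail₀ zs n))) ≈-refl p)
        λ k l → ≈-trans (≈-reflexive (at-tail₀ zs k)) (q (suc k) (s≤s l)))) (<-wf (at zs 0))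
    low {zs = zs} a (acc r) (less zero p q) =
      acc λ l → low a (r p) (<ᴸ-resp ≈ᴸ-refl (pointwise λ { zero → ≈-refl ; (suc n) → q (suc n) (s≤s z≤n) }) l)

  compareᴸ : ∀ xs ys → xs <ᴸ ys ⊎ xs ≈ᴸ ys ⊎ ys <ᴸ xs
  compareᴸ = go
    where
    shift : ∀ {xs ys} → tail₀ xs <ᴸ tail₀ ys → xs <ᴸ ys
    shift {xs} {ys} (less n b a) = less (suc n)
      (<-resp (≈-reflexive (at-tail₀ xs n)) (≈-reflexive (at-tail₀ ys n)) b)
      λ { (suc k) (s≤s l) → ≈-trans (≈-reflexive (sym (at-tail₀ xs k)))
            (≈-trans (a k l) (≈-reflexive (at-tail₀ ys k))) }
    tails : ∀ {xs ys} → tail₀ xs ≈ᴸ tail₀ ys → ∀ k → at xs (suc k) ≈ at ys (suc k)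
    tails {xs} {ys} e k = ≈-trans (≈-reflexive (sym (at-tail₀ xs k)))
      (≈-trans (at-≈ e k) (≈-reflexive (at-tail₀ ys k)))
    combine : ∀ xs ys → tail₀ xs <ᴸ tail₀ ys ⊎ tail₀ xs ≈ᴸ tail₀ ys ⊎ tail₀ ys <ᴸ tail₀ xs →
      xs <ᴸ ys ⊎ xs ≈ᴸ ys ⊎ ys <ᴸ xs
    combine xs ys (inj₁ p) = inj₁ (shift {xs} {ys} p)
    combine xs ys (inj₂ (inj₂ p)) = inj₂ (inj₂ (shift {ys} {xs} p))
    combine xs ys (inj₂ (inj₁ e)) with compare (at xs 0) (at ys 0)
    ... | inj₁ p = inj₁ (less 0 p λ { (suc k) _ → tails {xs} {ys} e k })
    ... | inj₂ (inj₂ p) = inj₂ (inj₂ (less 0 p λ { (suc k) _ → ≈-sym (tails {xs} {ys} e k) }))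
    ... | inj₂ (inj₁ p) = inj₂ (inj₁ (pointwise λ { zero → p ; (suc k) → tails {xs} {ys} e k }))
    go : ∀ xs ys → xs <ᴸ ys ⊎ xs ≈ᴸ ys ⊎ ys <ᴸ xs
    go []       []       = inj₂ (inj₁ ≈ᴸ-refl)
    go []       (y ∷ ys) = combine [] (y ∷ ys) (go [] ys)
    go (x ∷ xs) []       = combine (x ∷ xs) [] (go xs [])
    go (x ∷ xs) (y ∷ ys) = combine (x ∷ xs) (y ∷ ys) (go xs ys)

  +ᴸ-mono-< : ∀ g {xs ys} → xs <ᴸ ys → g +ᴸ xs <ᴸ g +ᴸ ys
  +ᴸ-mono-< g {xs} {ys} (less n b a) = less n
    (<-resp (≈-sym (at-+ g xs n)) (≈-sym (at-+ g ys n)) (+-mono-< (at g n) b))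
    λ k l → ≈-trans (at-+ g xs k) (≈-trans (∙-cong ≈-refl (a k l)) (≈-sym (at-+ g ys k)))

  -- nothing inserts the letter 0#, just e applies e to the next letter; beyond the end of the list
  -- the embedding continues as the identity.
  Eᴸ : Set
  Eᴸ = List (Maybe E)

  appᴸ : Eᴸ → List X → List X
  appᴸ []            xs       = xs
  appᴸ (nothing ∷ ι) xs       = 0# ∷ appᴸ ι xs
  appᴸ (just e ∷ ι)  []       = []
  appᴸ (just e ∷ ι)  (x ∷ xs) = app e x ∷ appᴸ ι xs

  -- The same action on arbitrary functions on ℕ. Through `at-app` the laws of `appᴸ` become
  -- inductions on `ι` alone.
  val : Eᴸ → (ℕ → X) → ℕ → X
  val []            f n       = f n
  val (nothing ∷ ι) f zero    = 0#
  val (nothing ∷ ι) f (suc n) = val ι f n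
  val (just e ∷ ι)  f zero    = app e (f zero)
  val (just e ∷ ι)  f (suc n) = val ι (f ∘ suc) n

  val-cong : ∀ ι {f g} → (∀ q → f q ≈ g q) → ∀ n → val ι f n ≈ val ι g n
  val-cong []            p n       = p n
  val-cong (nothing ∷ ι) p zero    = ≈-refl
  val-cong (nothing ∷ ι) p (suc n) = val-cong ι p n
  val-cong (just e ∷ ι)  p zero    = app-cong e (p zero)
  val-cong (just e ∷ ι)  p (suc n) = val-cong ι (p ∘ suc) n

  val-0 : ∀ ι n → val ι (λ _ → 0#) n ≈ 0#
  val-0 []            n       = ≈-refl
  val-0 (nothing ∷ ι) zero    = ≈-refl
  val-0 (nothing ∷ ι) (suc n) = val-0 ι n
  val-0 (just e ∷ ι)  zero    = app-0 e
  val-0 (just e ∷ ι)  (suc n) = val-0 ι n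

  at-app : ∀ ι xs n → at (appᴸ ι xs) n ≈ val ι (at xs) n
  at-app []            xs       n       = ≈-refl
  at-app (nothing ∷ ι) xs       zero    = ≈-refl
  at-app (nothing ∷ ι) xs       (suc n) = at-app ι xs n
  at-app (just e ∷ ι)  []       zero    = ≈-sym (app-0 e)
  at-app (just e ∷ ι)  []       (suc n) = ≈-sym (val-0 ι n)
  at-app (just e ∷ ι)  (x ∷ xs) zero    = ≈-refl
  at-app (just e ∷ ι)  (x ∷ xs) (suc n) = at-app ι xs n

  val-zip : ∀ (_∙_ : X → X → X) → 0# ≈ 0# ∙ 0# → (∀ e x y → app e (x ∙ y) ≈ app e x ∙ app e y) →
    ∀ ι f g n → val ι (λ q → f q ∙ g q) n ≈ val ι f n ∙ val ι g n
  val-zip _∙_ z h []            f g n       = ≈-refl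
  val-zip _∙_ z h (nothing ∷ ι) f g zero    = z
  val-zip _∙_ z h (nothing ∷ ι) f g (suc n) = val-zip _∙_ z h ι f g n
  val-zip _∙_ z h (just e ∷ ι)  f g zero    = h e _ _
  val-zip _∙_ z h (just e ∷ ι)  f g (suc n) = val-zip _∙_ z h ι (f ∘ suc) (g ∘ suc) n

  appᴸ-cong : ∀ ι {xs ys} → xs ≈ᴸ ys → appᴸ ι xs ≈ᴸ appᴸ ι ys
  appᴸ-cong ι {xs} {ys} p = pointwise λ n →
    ≈-trans (at-app ι xs n) (≈-trans (val-cong ι (at-≈ p) n) (≈-sym (at-app ι ys n)))

  appᴸ-0 : ∀ ι → appᴸ ι [] ≈ᴸ []
  appᴸ-0 ι = pointwise λ n → ≈-trans (at-app ι [] n) (val-0 ι n)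

  appᴸ-+ : ∀ ι xs ys → appᴸ ι (xs +ᴸ ys) ≈ᴸ appᴸ ι xs +ᴸ appᴸ ι ys
  appᴸ-+ ι xs ys = pointwise λ n → begin
    at (appᴸ ι (xs +ᴸ ys)) n              ≈⟨ at-app ι (xs +ᴸ ys) n ⟩
    val ι (at (xs +ᴸ ys)) n               ≈⟨ val-cong ι (at-+ xs ys) n ⟩
    val ι (λ q → at xs q + at ys q) n     ≈⟨ val-zip _+_ (≈-sym (identityˡ 0#)) app-+ ι _ _ n ⟩
    val ι (at xs) n + val ι (at ys) n     ≈⟨ ∙-cong (at-app ι xs n) (at-app ι ys n) ⟨
    at (appᴸ ι xs) n + at (appᴸ ι ys) n   ≈⟨ at-+ (appᴸ ι xs) (appᴸ ι ys) n ⟨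
    at (appᴸ ι xs +ᴸ appᴸ ι ys) n         ∎

  appᴸ-∸ : ∀ ι xs ys → appᴸ ι (xs ∸ᴸ ys) ≈ᴸ appᴸ ι xs ∸ᴸ appᴸ ι ys
  appᴸ-∸ ι xs ys = pointwise λ n → begin
    at (appᴸ ι (xs ∸ᴸ ys)) n              ≈⟨ at-app ι (xs ∸ᴸ ys) n ⟩
    val ι (at (xs ∸ᴸ ys)) n               ≈⟨ val-cong ι (at-∸ xs ys) n ⟩
    val ι (λ q → at xs q ∸ at ys q) n     ≈⟨ val-zip _∸_ (≈-sym 0∸0) app-∸ ι _ _ n ⟩
    val ι (at xs) n ∸ val ι (at ys) n     ≈⟨ ∸-cong (at-app ι xs n) (at-app ι ys n) ⟨
    at (appᴸ ι xs) n ∸ at (appᴸ ι ys) n   ≈⟨ at-∸ (appᴸ ι xs) (appᴸ ι ys) n ⟨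
    at (appᴸ ι xs ∸ᴸ appᴸ ι ys) n         ∎

  val-< : ∀ ι {f g} n → f n < g n → (∀ k → n ℕ.< k → f k ≈ g k) →
    ∃ λ m → val ι f m < val ι g m × (∀ k → m ℕ.< k → val ι f k ≈ val ι g k)
  val-< []            n       b a = n , b , a
  val-< (nothing ∷ ι) n       b a =
    let m , b′ , a′ = val-< ι n b a in suc m , b′ , λ { (suc k) (s≤s l) → a′ k l }
  val-< (just e ∷ ι)  zero    b a = zero , app-< e b ,
    λ { (suc k) _ → val-cong ι (λ q → a (suc q) (s≤s z≤n)) k }
  val-< (just e ∷ ι)  (suc n) b a =
    let m , b′ , a′ = val-< ι n b (λ k l → a (suc k) (s≤s l)) in
    suc m , b′ , λ { (suc k) (s≤s l) → a′ k l }

  appᴸ-< : ∀ ι {xs ys} → xs <ᴸ ys → appᴸ ι xs <ᴸ appᴸ ι ys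
  appᴸ-< ι {xs} {ys} (less n b a) =
    let m , b′ , a′ = val-< ι n b a in
    less m (<-resp (≈-sym (at-app ι xs m)) (≈-sym (at-app ι ys m)) b′)
      λ k l → ≈-trans (at-app ι xs k) (≈-trans (a′ k l) (≈-sym (at-app ι ys k)))

  _∘ᴸ_ : Eᴸ → Eᴸ → Eᴸ
  []            ∘ᴸ κ             = κ
  (i ∷ ι)       ∘ᴸ []            = i ∷ ι
  (nothing ∷ ι) ∘ᴸ (k ∷ κ)       = nothing ∷ (ι ∘ᴸ (k ∷ κ))
  (just e ∷ ι)  ∘ᴸ (nothing ∷ κ) = nothing ∷ (ι ∘ᴸ κ)
  (just e ∷ ι)  ∘ᴸ (just f ∷ κ)  = just (e ∘E f) ∷ (ι ∘ᴸ κ)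

  val-∘ : ∀ ι κ f n → val (ι ∘ᴸ κ) f n ≈ val ι (val κ f) n
  val-∘ []            κ             f n       = ≈-refl
  val-∘ (i ∷ ι)       []            f n       = ≈-refl
  val-∘ (nothing ∷ ι) (k ∷ κ)       f zero    = ≈-refl
  val-∘ (nothing ∷ ι) (k ∷ κ)       f (suc n) = val-∘ ι (k ∷ κ) f n
  val-∘ (just e ∷ ι)  (nothing ∷ κ) f zero    = ≈-sym (app-0 e)
  val-∘ (just e ∷ ι)  (nothing ∷ κ) f (suc n) = val-∘ ι κ f n
  val-∘ (just e ∷ ι)  (just e′ ∷ κ) f zero    = app-∘ e e′ (f zero)
  val-∘ (just e ∷ ι)  (just e′ ∷ κ) f (suc n) = val-∘ ι κ (f ∘ suc) n

  appᴸ-∘ : ∀ ι κ xs → appᴸ (ι ∘ᴸ κ) xs ≈ᴸ appᴸ ι (appᴸ κ xs)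
  appᴸ-∘ ι κ xs = pointwise λ n → begin
    at (appᴸ (ι ∘ᴸ κ) xs) n      ≈⟨ at-app (ι ∘ᴸ κ) xs n ⟩
    val (ι ∘ᴸ κ) (at xs) n       ≈⟨ val-∘ ι κ (at xs) n ⟩
    val ι (val κ (at xs)) n      ≈⟨ val-cong ι (at-app κ xs) n ⟨
    val ι (at (appᴸ κ xs)) n     ≈⟨ at-app ι (appᴸ κ xs) n ⟨
    at (appᴸ ι (appᴸ κ xs)) n    ∎

  _≼ᴸ_ : List X → List X → Set
  hs ≼ᴸ ss = ∃₂ λ g ι → ss ≈ᴸ g +ᴸ appᴸ ι hs

  keepᴸ : ∀ {x xs y ys} → x ≼ y → xs ≼ᴸ ys → (x ∷ xs) ≼ᴸ (y ∷ ys)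
  keepᴸ (g , e , p) (gs , ι , q) = g ∷ gs , just e ∷ ι , ∷-≈ p q

  skipᴸ : ∀ {xs y ys} → xs ≼ᴸ ys → xs ≼ᴸ (y ∷ ys)
  skipᴸ {y = y} (gs , ι , q) = y ∷ gs , nothing ∷ ι , ∷-≈ (≈-sym (identityʳ y)) q

  -- A skipped letter corresponds to an inserted `0#` and goes wholly into the cofactor; a kept
  -- letter is divided. This is how Higman's lemma carries almost-fullness over to one more
  -- coordinate.
  emb⇒≼ᴸ : ∀ xs ys → Emb _≼_ xs ys → xs ≼ᴸ ys
  emb⇒≼ᴸ _ ys [] = ys , [] , ≈ᴸ-sym (+ᴸ-identityʳ ys)
  emb⇒≼ᴸ _ _ (skip p) = skipᴸ (emb⇒≼ᴸ _ _ p)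
  emb⇒≼ᴸ _ _ (keep r p) = keepᴸ r (emb⇒≼ᴸ _ _ p)

  ≼ᴸ-af : AF _≼ᴸ_
  ≼ᴸ-af = af-mono emb⇒≼ᴸ (higman _≼?_ ≼-af)

  ≈0⇒≼ᴸ0 : ∀ {xs} → xs ≈ᴸ [] → xs ≼ᴸ []
  ≈0⇒≼ᴸ0 {xs} p = [] , [] , ≈ᴸ-sym (≈ᴸ-trans (+ᴸ-identityˡ xs) p)

  ≼ᴸ0⇒≈0 : ∀ {xs} → xs ≼ᴸ [] → xs ≈ᴸ []
  ≼ᴸ0⇒≈0 {xs} (g , ι , p) = pointwise λ n →
    zeros ι (at xs) (at g)
      (λ m → ≈-trans (at-≈ p m) (≈-trans (at-+ g (appᴸ ι xs) m) (∙-cong ≈-refl (at-app ι xs m)))) n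
    where
    zeros : ∀ ι (f g : ℕ → X) → (∀ m → 0# ≈ g m + val ι f m) → ∀ n → f n ≈ 0#
    zeros []            f g p n       =
      ≼0⇒≈0 (g n , idE , ≈-trans (p n) (∙-cong ≈-refl (≈-sym (app-id (f n)))))
    zeros (nothing ∷ ι) f g p n       = zeros ι f (g ∘ suc) (p ∘ suc) n
    zeros (just e ∷ ι)  f g p zero    = ≼0⇒≈0 (g zero , e , p zero)
    zeros (just e ∷ ι)  f g p (suc n) = zeros ι (f ∘ suc) (g ∘ suc) (p ∘ suc) n

  ≼ᴸ-∷⁻ : ∀ {x xs y ys} → (x ∷ xs) ≼ᴸ (y ∷ ys) → (x ≼ y × xs ≼ᴸ ys) ⊎ (x ∷ xs) ≼ᴸ ys
  ≼ᴸ-∷⁻ {x} {xs} {y} {ys} (g , ι , p) = go ι p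
    where
    head≈ : ∀ zs → y ∷ ys ≈ᴸ g +ᴸ zs → y ≈ at g 0 + at zs 0
    head≈ zs p = ≈-trans (at-≈ p 0) (at-+ g zs 0)
    tail≈ : ∀ zs → y ∷ ys ≈ᴸ g +ᴸ zs → ys ≈ᴸ tail₀ g +ᴸ tail₀ zs
    tail≈ zs p = pointwise λ n → ≈-trans (at-≈ p (suc n)) (≈-trans (at-+ g zs (suc n))
      (≈-sym (≈-trans (at-+ (tail₀ g) (tail₀ zs) n)
        (∙-cong (≈-reflexive (at-tail₀ g n)) (≈-reflexive (at-tail₀ zs n))))))
    go : ∀ ι → y ∷ ys ≈ᴸ g +ᴸ appᴸ ι (x ∷ xs) → (x ≼ y × xs ≼ᴸ ys) ⊎ (x ∷ xs) ≼ᴸ ys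
    go [] p = inj₁ ((at g 0 , idE , ≈-trans (head≈ (x ∷ xs) p) (∙-cong ≈-refl (≈-sym (app-id x))))
                   , (tail₀ g , [] , tail≈ (x ∷ xs) p))
    go (nothing ∷ ι) p = inj₂ (tail₀ g , ι , tail≈ (0# ∷ appᴸ ι (x ∷ xs)) p)
    go (just e ∷ ι) p = inj₁ ((at g 0 , e , head≈ (app e x ∷ appᴸ ι xs) p)
                             , (tail₀ g , ι , tail≈ (app e x ∷ appᴸ ι xs) p))

  _≼ᴸ?_ : ∀ xs ys → Dec (xs ≼ᴸ ys)
  []       ≼ᴸ? ys = yes (ys , [] , ≈ᴸ-sym (+ᴸ-identityʳ ys))
  (x ∷ xs) ≼ᴸ? [] = map′ ≈0⇒≼ᴸ0 ≼ᴸ0⇒≈0 ((x ∷ xs) ≟ᴸ [])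
  (x ∷ xs) ≼ᴸ? (y ∷ ys) with (x ≼? y) ×-dec (xs ≼ᴸ? ys) | (x ∷ xs) ≼ᴸ? ys
  ... | yes (p , q) | _     = yes (keepᴸ p q)
  ... | no _        | yes q = yes (skipᴸ q)
  ... | no ¬p       | no ¬q = no λ r → [ ¬p , ¬q ]′ (≼ᴸ-∷⁻ r)

  -- One number bounding both the length and the sizes of all entries, the two quantities that limit
  -- the overlaps to be listed.
  sizeᴸ : List X → ℕ
  sizeᴸ []       = 0
  sizeᴸ (x ∷ xs) = size x ⊔ suc (sizeᴸ xs)

  both : E × E → Eᴸ × Eᴸ → Eᴸ × Eᴸ
  both (c , c′) (ι , κ) = just c ∷ ι , just c′ ∷ κ

  left right : Eᴸ × Eᴸ → Eᴸ × Eᴸ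
  left  (ι , κ) = just idE ∷ ι , nothing ∷ κ
  right (ι , κ) = nothing ∷ ι , just idE ∷ κ

  -- The relative positions of two embeddings of segments of lengths `m` and `n`, enumerated like
  -- Delannoy paths: each position in the union of the images belongs to the first image only, to
  -- the second only, or to both. Once one segment is used up, the rest of the other embedding is
  -- left to the common factor.
  shuffles : ℕ → ℕ → ℕ → List (Eᴸ × Eᴸ)
  shuffles N zero    _       = ([] , []) ∷ []
  shuffles N (suc m) zero    = ([] , []) ∷ []
  shuffles N (suc m) (suc n) =
    map left (shuffles N m (suc n)) ++
    map right (shuffles N (suc m) n) ++
    cartesianProductWith both (overlaps N) (shuffles N m n)

  data Bounded (N : ℕ) : ℕ → List X → Set where
    []  : ∀ {n} → Bounded N n []
    _∷_ : ∀ {n x xs} → size x ℕ.≤ N → Bounded N n xs → Bounded N (suc n) (x ∷ xs)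

  bounded : ∀ {N} n xs → sizeᴸ xs ℕ.≤ N → sizeᴸ xs ℕ.≤ n → Bounded N n xs
  bounded n       []       p q = []
  bounded zero    (x ∷ xs) p q with ℕ.≤-trans (ℕ.m≤n⊔m (size x) (suc (sizeᴸ xs))) q
  ... | ()
  bounded (suc n) (x ∷ xs) p q =
    ℕ.≤-trans (ℕ.m≤m⊔n (size x) (suc (sizeᴸ xs))) p ∷
    bounded n xs
      (ℕ.≤-trans (ℕ.n≤1+n _) (ℕ.≤-trans (ℕ.m≤n⊔m (size x) (suc (sizeᴸ xs))) p))
      (ℕ.≤-pred (ℕ.≤-trans (ℕ.m≤n⊔m (size x) (suc (sizeᴸ xs))) q))

  Factors : ℕ → ℕ → ℕ → Eᴸ → Eᴸ → Set
  Factors N m n ι κ = ∃₂ λ c c′ → (c , c′) ∈ shuffles N m n × ∃ λ f →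
    (∀ xs → Bounded N m xs → appᴸ ι xs ≈ᴸ appᴸ f (appᴸ c xs)) ×
    (∀ xs → Bounded N n xs → appᴸ κ xs ≈ᴸ appᴸ f (appᴸ c′ xs))

  factor-left : ∀ {N m n e ι κ} → Factors N m (suc n) ι κ →
    Factors N (suc m) (suc n) (just e ∷ ι) (nothing ∷ κ)
  factor-left {e = e} (c , c′ , i , f , p , q) =
    _ , _ , ∈-++⁺ˡ (∈-map⁺ left i) , just e ∷ f ,
    (λ { [] [] → ≈ᴸ-refl
       ; (x ∷ xs) (_ ∷ b) → ∷-≈ (app-cong e (≈-sym (app-id x))) (p xs b) }) ,
    (λ xs b → ∷-≈ (≈-sym (app-0 e)) (q xs b))

  factor-right : ∀ {N m n e ι κ} → Factors N (suc m) n ι κ →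
    Factors N (suc m) (suc n) (nothing ∷ ι) (just e ∷ κ)
  factor-right {N} {m} {n} {e} (c , c′ , i , f , p , q) =
    _ , _ , ∈-++⁺ʳ (map left (shuffles N m (suc n))) (∈-++⁺ˡ (∈-map⁺ right i)) , just e ∷ f ,
    (λ xs b → ∷-≈ (≈-sym (app-0 e)) (p xs b)) ,
    (λ { [] [] → ≈ᴸ-refl
       ; (x ∷ xs) (_ ∷ b) → ∷-≈ (app-cong e (≈-sym (app-id x))) (q xs b) })

  factor-both : ∀ {N m n e e′ ι κ} → Factors N m n ι κ →
    Factors N (suc m) (suc n) (just e ∷ ι) (just e′ ∷ κ)
  factor-both {N} {m} {n} {e} {e′} (c , c′ , i , f , p , q) =
    let d , d′ , j , k , p′ , q′ = overlaps-complete N e e′ in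
    _ , _ , ∈-++⁺ʳ (map left (shuffles N m (suc n))) (∈-++⁺ʳ (map right (shuffles N (suc m) n))
      (∈-cartesianProductWith⁺ both j i)) , just k ∷ f ,
    (λ { [] [] → ≈ᴸ-refl ; (x ∷ xs) (s ∷ b) → ∷-≈ (p′ x s) (p xs b) }) ,
    (λ { [] [] → ≈ᴸ-refl ; (x ∷ xs) (s ∷ b) → ∷-≈ (q′ x s) (q xs b) })

  factor-insert : ∀ {N m n ι κ} → Factors N m n ι κ → Factors N m n (nothing ∷ ι) (nothing ∷ κ)
  factor-insert (c , c′ , i , f , p , q) = c , c′ , i , nothing ∷ f ,
    (λ xs b → ∷-≈ ≈-refl (p xs b)) , (λ xs b → ∷-≈ ≈-refl (q xs b))

  unfold-id : ∀ xs → appᴸ (just idE ∷ []) xs ≈ᴸ xs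
  unfold-id []       = ≈ᴸ-refl
  unfold-id (x ∷ xs) = ∷-≈ (app-id x) ≈ᴸ-refl

  factor-idˡ : ∀ {N m n κ} → Factors N m n (just idE ∷ []) κ → Factors N m n [] κ
  factor-idˡ (c , c′ , i , f , p , q) =
    c , c′ , i , f , (λ xs b → ≈ᴸ-trans (≈ᴸ-sym (unfold-id xs)) (p xs b)) , q

  factor-idʳ : ∀ {N m n ι} → Factors N m n ι (just idE ∷ []) → Factors N m n ι []
  factor-idʳ (c , c′ , i , f , p , q) =
    c , c′ , i , f , p , (λ xs b → ≈ᴸ-trans (≈ᴸ-sym (unfold-id xs)) (q xs b))

  -- Both lists are read in parallel. A position outside both images goes into the common factor
  -- alone (`factor-insert`); an exhausted list continues as the identity and is unfolded to
  -- `just idE ∷ []`.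
  factor : ∀ N m n ι κ → Factors N m n ι κ
  factor N zero n ι κ =
    [] , [] , here refl , κ , (λ { [] [] → ≈ᴸ-trans (appᴸ-0 ι) (≈ᴸ-sym (appᴸ-0 κ)) }) , (λ _ _ → ≈ᴸ-refl)
  factor N (suc m) zero ι κ =
    [] , [] , here refl , ι , (λ _ _ → ≈ᴸ-refl) , (λ { [] [] → ≈ᴸ-trans (appᴸ-0 κ) (≈ᴸ-sym (appᴸ-0 ι)) })
  factor N (suc m) (suc n) (nothing ∷ ι) (nothing ∷ κ) = factor-insert (factor N (suc m) (suc n) ι κ)
  factor N (suc m) (suc n) (nothing ∷ ι) (just e ∷ κ)  = factor-right (factor N (suc m) n ι κ)
  factor N (suc m) (suc n) (just e ∷ ι)  (nothing ∷ κ) = factor-left (factor N m (suc n) ι κ)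
  factor N (suc m) (suc n) (just e ∷ ι)  (just e′ ∷ κ) = factor-both (factor N m n ι κ)
  factor N (suc m) (suc n) []            (nothing ∷ κ) = factor-idˡ {κ = nothing ∷ κ} (factor-left (factor N m (suc n) [] κ))
  factor N (suc m) (suc n) []            (just e ∷ κ)  = factor-idˡ (factor-both (factor N m n [] κ))
  factor N (suc m) (suc n) (nothing ∷ ι) []            = factor-idʳ {ι = nothing ∷ ι} (factor-right (factor N (suc m) n ι []))
  factor N (suc m) (suc n) (just e ∷ ι)  []            = factor-idʳ (factor-both (factor N m n ι []))
  factor N (suc m) (suc n) []            []            =
    factor-idˡ (factor-idʳ (factor-both (factor N m n [] [])))

lift : MonomialSystem → MonomialSystem
lift S = record
  { X = List X ; _≈_ = _≈ᴸ_ ; 0# = [] ; _+_ = _+ᴸ_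
  ; isCommutativeMonoid = record
    { isMonoid = record
      { isSemigroup = record
        { isMagma = record
          { isEquivalence = record { refl = ≈ᴸ-refl ; sym = ≈ᴸ-sym ; trans = ≈ᴸ-trans }
          ; ∙-cong = +ᴸ-cong }
        ; assoc = +ᴸ-assoc }
      ; identity = +ᴸ-identityˡ , +ᴸ-identityʳ }
    ; comm = +ᴸ-comm }
  ; _≟_ = _≟ᴸ_
  ; _∸_ = _∸ᴸ_ ; ∸-cong = ∸ᴸ-cong ; 0∸0 = ≈ᴸ-refl ; ∸-balance = ∸ᴸ-balance ; ∸-minimal = ∸ᴸ-minimal
  ; _<_ = _<ᴸ_ ; <-resp = <ᴸ-resp ; <-wf = <ᴸ-wf ; compare = compareᴸ ; ≮0 = ≮0ᴸ
  ; +-mono-< = +ᴸ-mono-<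
  ; E = Eᴸ ; app = appᴸ ; idE = [] ; _∘E_ = _∘ᴸ_
  ; app-cong = appᴸ-cong ; app-0 = appᴸ-0 ; app-+ = appᴸ-+ ; app-∸ = appᴸ-∸
  ; app-< = appᴸ-< ; app-id = λ _ → ≈ᴸ-refl ; app-∘ = appᴸ-∘
  ; _≼?_ = _≼ᴸ?_ ; ≼-af = ≼ᴸ-af ; ≼0⇒≈0 = ≼ᴸ0⇒≈0
  ; size = sizeᴸ ; overlaps = λ N → shuffles N N N
  ; overlaps-complete = λ N ι κ →
      let c , c′ , i , f , p , q = factor N N N ι κ in
      c , c′ , i , f , (λ xs s → p xs (bounded N xs s s)) , (λ xs s → q xs (bounded N xs s s))
  }
  where
  open MonomialSystem S
  open Lift S

sys : ℕ → ℕ → MonomialSystem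
sys d zero    = base d
sys d (suc m) = lift (sys d m)

-- Completion of congruences

module Completion (S : MonomialSystem) where
  open MonomialSystem S
  open import Relation.Binary.Reasoning.Setoid setoid

  Rules : Set
  Rules = List (X × X)

  record Rewrite (R : Rules) (s t : X) : Set where
    constructor rewriting
    field
      {lhs rhs} : X
      rule∈ : (lhs , rhs) ∈ R
      g     : X
      e     : E
      s≈    : s ≈ g + app e lhs
      t≈    : t ≈ g + app e rhs

  rewrite-ctx : ∀ {R s t} g e → Rewrite R s t → Rewrite R (g + app e s) (g + app e t)
  rewrite-ctx g e (rewriting r∈ g′ e′ p q) =
    rewriting r∈ (g + app e g′) (e ∘E e′) (move p) (move q)
    where
    move : ∀ {s h} → s ≈ g′ + app e′ h → g + app e s ≈ (g + app e g′) + app (e ∘E e′) h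
    move {s} {h} p = begin
      g + app e s                              ≈⟨ ∙-cong ≈-refl (app-cong e p) ⟩
      g + app e (g′ + app e′ h)                ≈⟨ ∙-cong ≈-refl (app-+ e g′ (app e′ h)) ⟩
      g + (app e g′ + app e (app e′ h))        ≈⟨ assoc g _ _ ⟨
      (g + app e g′) + app e (app e′ h)        ≈⟨ ∙-cong ≈-refl (app-∘ e e′ h) ⟨
      (g + app e g′) + app (e ∘E e′) h         ∎

  module _ (G : Rules) where

    infix 4 _∼_
    data _∼_ : X → X → Set where
      ≈⇒∼       : ∀ {s t} → s ≈ t → s ∼ t
      rewrite⇒∼ : ∀ {s t} → Rewrite G s t → s ∼ t
      ∼-sym     : ∀ {s t} → s ∼ t → t ∼ s
      ∼-trans   : ∀ {s t u} → s ∼ t → t ∼ u → s ∼ u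

    ∼-ctx : ∀ {s t} g e → s ∼ t → g + app e s ∼ g + app e t
    ∼-ctx g e (≈⇒∼ p)       = ≈⇒∼ (∙-cong ≈-refl (app-cong e p))
    ∼-ctx g e (rewrite⇒∼ p) = rewrite⇒∼ (rewrite-ctx g e p)
    ∼-ctx g e (∼-sym p)     = ∼-sym (∼-ctx g e p)
    ∼-ctx g e (∼-trans p q) = ∼-trans (∼-ctx g e p) (∼-ctx g e q)

    Sound : X × X → Set
    Sound (h , h′) = h′ < h × h ∼ h′

    module _ (R : Rules) (sound : All Sound R) where

      Irreducible : X → Set
      Irreducible s = ¬ Any (λ r → proj₁ r ≼ s) R

      rewrite-sound : ∀ {s t} → Rewrite R s t → s ∼ t
      rewrite-sound (rewriting r∈ g e p q) = ∼-trans (≈⇒∼ p)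
        (∼-trans (∼-ctx g e (proj₂ (lookup sound r∈))) (≈⇒∼ (≈-sym q)))

      rewrite-decreasing : ∀ {s t} → Rewrite R s t → t < s
      rewrite-decreasing (rewriting r∈ g e p q) =
        <-resp (≈-sym q) (≈-sym p) (+-mono-< g (app-< e (proj₁ (lookup sound r∈))))

      infix 4 _⇓_
      data _⇓_ : X → X → Set where
        done : ∀ {s n} → s ≈ n → Irreducible s → s ⇓ n
        more : ∀ {s t n} → Rewrite R s t → t ⇓ n → s ⇓ n

      normalise : ∀ s → ∃ (s ⇓_)
      normalise s = go s (<-wf s)
        where
        go : ∀ s → Acc _<_ s → ∃ (s ⇓_)
        go s (acc rs) with any? (λ r → proj₁ r ≼? s) R
        ... | no irr = s , done ≈-refl irr
        ... | yes a =
          let r , r∈ , g , e , p = find a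
              step = rewriting r∈ g e p ≈-refl
              n , d = go (g + app e (proj₂ r)) (rs (rewrite-decreasing step))
          in n , more step d

      ⇓-sound : ∀ {s n} → s ⇓ n → s ∼ n
      ⇓-sound (done p _) = ≈⇒∼ p
      ⇓-sound (more r d) = ∼-trans (rewrite-sound r) (⇓-sound d)

      irreducible-resp : ∀ {s t} → s ≈ t → Irreducible s → Irreducible t
      irreducible-resp p irr a =
        let r , r∈ , g , e , q = find a in irr (lose r∈ (g , e , ≈-trans p q))

      ⇓-irreducible : ∀ {s n} → s ⇓ n → Irreducible n
      ⇓-irreducible (done p irr) = irreducible-resp p irr
      ⇓-irreducible (more _ d)   = ⇓-irreducible d

      ⇓-respˡ : ∀ {s t n} → s ≈ t → s ⇓ n → t ⇓ n
      ⇓-respˡ p (done q irr) = done (≈-trans (≈-sym p) q) (irreducible-resp p irr)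
      ⇓-respˡ p (more (rewriting r∈ g e q q′) d) =
        more (rewriting r∈ g e (≈-trans (≈-sym p) q) q′) d

      ⇓-ctx : ∀ {s n m} g e → s ⇓ n → g + app e n ⇓ m → g + app e s ⇓ m
      ⇓-ctx g e (done p _) c = ⇓-respˡ (∙-cong ≈-refl (app-cong e (≈-sym p))) c
      ⇓-ctx g e (more r d) c = more (rewrite-ctx g e r) (⇓-ctx g e d c)

      Joinable : X × X → Set
      Joinable (a , b) = ∃₂ λ m n → a ⇓ m × b ⇓ n × m ≈ n

      -- A normal form may become reducible again inside a context; normalising one of the two there
      -- serves both sides, as they agree up to `_≈_`.
      joinable-ctx : ∀ {a b} g e → Joinable (a , b) → ∃ λ m → g + app e a ⇓ m × g + app e b ⇓ m
      joinable-ctx g e (w , w′ , p , q , w≈w′) =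
        let m , d = normalise (g + app e w) in
        m , ⇓-ctx g e p d , ⇓-ctx g e q (⇓-respˡ (∙-cong ≈-refl (app-cong e w≈w′)) d)

      rule-size : X × X → ℕ
      rule-size (h , h′) = size h ⊔ size h′

      -- Buchberger's S-pair: the least common multiple of the two renamed left-hand sides,
      -- rewritten by either rule. Overlaps without a shared variable are among those listed, so
      -- disjoint redexes are covered as well.
      critical : X × X → X × X → E × E → X × X
      critical (h , h′) (k , k′) (c , c′) =
        (app c′ k ∸ app c h) + app c h′ , (app c h ∸ app c′ k) + app c′ k′

      criticals : X × X → X × X → List (X × X)
      criticals r r′ = map (critical r r′) (overlaps (rule-size r ⊔ rule-size r′))

      -- Completion starts from no rules at all, so the generators enter as obligations: their
      -- failure to be joinable produces the first rules, and their joinability in the end makes the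
      -- rules capture all of `_∼_`.
      obligations : List (X × X)
      obligations = G ++ concatMap (λ r → concatMap (criticals r) R) R

      critical∈ : ∀ {r r′ cc} → r ∈ R → r′ ∈ R → cc ∈ overlaps (rule-size r ⊔ rule-size r′) →
        critical r r′ cc ∈ obligations
      critical∈ {r} r∈ r′∈ cc∈ = ∈-++⁺ʳ G (∈-concatMap⁺ (λ r → concatMap (criticals r) R)
        (lose r∈ (∈-concatMap⁺ (criticals r) (lose r′∈ (∈-map⁺ (critical r _) cc∈)))))

      obligation-sound : ∀ {a b} → (a , b) ∈ obligations → a ∼ b
      obligation-sound {a} {b} i with ∈-++⁻ G i
      ... | inj₁ j = rewrite⇒∼ (rewriting j 0# idE (unit a) (unit b))
        where
        unit : ∀ x → x ≈ 0# + app idE x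
        unit x = ≈-sym (≈-trans (identityˡ _) (app-id x))
      ... | inj₂ j with find (∈-concatMap⁻ (λ r → concatMap (criticals r) R) {xs = R} j)
      ...   | (h , h′) , r∈ , j′ with find (∈-concatMap⁻ (criticals (h , h′)) {xs = R} j′)
      ...     | (k , k′) , r′∈ , j″ with ∈-map⁻ (critical (h , h′) (k , k′)) j″
      ...       | (c , c′) , _ , refl = ∼-trans (∼-sym (∼-ctx _ c (proj₂ (lookup sound r∈))))
        (∼-trans (≈⇒∼ (∸-balance (app c h) (app c′ k))) (∼-ctx _ c′ (proj₂ (lookup sound r′∈))))

      module _ (joined : All Joinable obligations) where

        -- The critical pair lemma. Both renamings factor through one `f`, and `s`, a common
        -- multiple of the two redexes, is `r` times the image under `f` of the least common
        -- multiple of `x` and `y`. Hence `t` and `u` are the two sides of a critical pair in a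
        -- common context.
        locally-confluent : ∀ {s t u} → Rewrite R s t → Rewrite R s u → ∃ λ m → t ⇓ m × u ⇓ m
        locally-confluent {s} {t} {u}
            (rewriting {h} {h′} r∈ g e p p′) (rewriting {k} {k′} r′∈ g₁ e₁ q q′) =
          let c , c′ , cc∈ , f , fac , fac′ = overlaps-complete N e e₁
              fh = fac h (ℕ.≤-trans (ℕ.m≤m⊔n (size h) (size h′)) (ℕ.m≤m⊔n Nh Nk))
              fh′ = fac h′ (ℕ.≤-trans (ℕ.m≤n⊔m (size h) (size h′)) (ℕ.m≤m⊔n Nh Nk))
              fk = fac′ k (ℕ.≤-trans (ℕ.m≤m⊔n (size k) (size k′)) (ℕ.m≤n⊔m Nh Nk))
              fk′ = fac′ k′ (ℕ.≤-trans (ℕ.m≤n⊔m (size k) (size k′)) (ℕ.m≤n⊔m Nh Nk))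
              x = app c h
              y = app c′ k
              r = g ∸ (app f y ∸ app f x)
              same : g + app f x ≈ g₁ + app f y
              same = begin
                g + app f x    ≈⟨ ∙-cong ≈-refl fh ⟨
                g + app e h    ≈⟨ p ⟨
                s              ≈⟨ q ⟩
                g₁ + app e₁ k  ≈⟨ ∙-cong ≈-refl fk ⟩
                g₁ + app f y   ∎
              g≈ , g₁≈ = ∸-minimal same
              m , d , d₁ = joinable-ctx r f (lookup joined (critical∈ r∈ r′∈ cc∈))
          in m , ⇓-respˡ (≈-sym (regroup p′ fh′ g≈)) d , ⇓-respˡ (≈-sym (regroup q′ fk′ g₁≈)) d₁
          where
          Nh Nk N : ℕ
          Nh = rule-size (h , h′)
          Nk = rule-size (k , k′)
          N = Nh ⊔ Nk
          regroup : ∀ {t g e h r f x y z} → t ≈ g + app e h → app e h ≈ app f z →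
            g ≈ r + (app f y ∸ app f x) → t ≈ r + app f ((y ∸ x) + z)
          regroup {t} {g} {e} {h} {r} {f} {x} {y} {z} p q a = begin
            t                                       ≈⟨ p ⟩
            g + app e h                             ≈⟨ ∙-cong a q ⟩
            (r + (app f y ∸ app f x)) + app f z     ≈⟨ assoc r _ _ ⟩
            r + ((app f y ∸ app f x) + app f z)     ≈⟨ ∙-cong ≈-refl (∙-cong (app-∸ f y x) ≈-refl) ⟨
            r + (app f (y ∸ x) + app f z)           ≈⟨ ∙-cong ≈-refl (app-+ f (y ∸ x) z) ⟨
            r + app f ((y ∸ x) + z)                 ∎

        -- Newman's argument, with the monomial order as the induction measure.
        unique : ∀ {s m n} → Acc _<_ s → s ⇓ m → s ⇓ n → m ≈ n
        unique a (done p _) (done q _) = ≈-trans (≈-sym p) q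
        unique a (done _ irr) (more (rewriting r∈ g e p _) _) = ⊥-elim (irr (lose r∈ (g , e , p)))
        unique a (more (rewriting r∈ g e p _) _) (done _ irr) = ⊥-elim (irr (lose r∈ (g , e , p)))
        unique (acc rs) (more r d) (more r′ d′) =
          let _ , c , c′ = locally-confluent r r′ in
          ≈-trans (unique (rs (rewrite-decreasing r)) d c)
                  (unique (rs (rewrite-decreasing r′)) c′ d′)

        ∼⇒normal-≈ : ∀ {s t m n} → s ∼ t → s ⇓ m → t ⇓ n → m ≈ n
        ∼⇒normal-≈ (≈⇒∼ p) c d = unique (<-wf _) (⇓-respˡ p c) d
        ∼⇒normal-≈ (rewrite⇒∼ (rewriting r∈ g e p q)) c d =
          let _ , c′ , d′ = joinable-ctx g e (lookup joined (∈-++⁺ˡ r∈)) in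
          ≈-trans (unique (<-wf _) c (⇓-respˡ (≈-sym p) c′)) (unique (<-wf _) (⇓-respˡ (≈-sym q) d′) d)
        ∼⇒normal-≈ (∼-sym p) c d = ≈-sym (∼⇒normal-≈ p d c)
        ∼⇒normal-≈ (∼-trans p q) c d =
          let _ , b = normalise _ in ≈-trans (∼⇒normal-≈ p c b) (∼⇒normal-≈ q b d)

        ∼-decidable : ∀ s t → Dec (s ∼ t)
        ∼-decidable s t with normalise s | normalise t
        ... | m , c | n , d with m ≟ n
        ...   | yes p = yes (∼-trans (⇓-sound c) (∼-trans (≈⇒∼ p) (∼-sym (⇓-sound d))))
        ...   | no ¬p = no λ q → ¬p (∼⇒normal-≈ q c d)

      check : ∀ L → All Joinable L ⊎
        ∃₂ λ a b → (a , b) ∈ L × ∃₂ λ m n → a ⇓ m × b ⇓ n × ¬ (m ≈ n)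
      check [] = inj₁ []
      check ((a , b) ∷ L) with normalise a | normalise b
      ... | m , c | n , d with m ≟ n | check L
      ...   | no ¬p | _ = inj₂ (a , b , here refl , m , n , c , d , ¬p)
      ...   | yes p | inj₁ all = inj₁ ((m , n , c , d , p) ∷ all)
      ...   | yes _ | inj₂ (a′ , b′ , i , rest) = inj₂ (a′ , b′ , there i , rest)

    -- The invariant that ties the relation `P` reached in the almost-full proof to the rules found
    -- so far: `P` exceeds `_≼_` only at reducible `y`. Adding a rule with left-hand side `a`
    -- preserves it because `a` is irreducible, so `P a y` can only mean `a ≼ y`.
    Covers : (X → X → Set) → Rules → Set
    Covers P R = ∀ y z → P y z → y ≼ z ⊎ Any (λ r → proj₁ r ≼ y) R

    -- The left-hand side of each added rule is irreducible, so the left-hand sides form a bad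
    -- sequence for ≼ and the recursion descends in the proof that ≼ is almost full.
    complete : ∀ {P} → AF P → (R : Rules) (sound : All Sound R) → Covers P R → ∀ s t → Dec (s ∼ t)
    complete-with : ∀ {P} → AF P → (R : Rules) (sound : All Sound R) → Covers P R →
      ∀ {a b} → Irreducible R sound a → b < a → a ∼ b → ∀ s t → Dec (s ∼ t)

    complete af R sound cov s t with check R sound (obligations R sound)
    ... | inj₁ joined = ∼-decidable R sound joined s t
    ... | inj₂ (a , b , i , m , n , c , d , m≉n) with compare m n
    ...   | inj₂ (inj₁ p) = ⊥-elim (m≉n p)
    ...   | inj₁ p = complete-with af R sound cov (⇓-irreducible R sound d) p
            (∼-sym (∼-trans (∼-sym (⇓-sound R sound c))
              (∼-trans (obligation-sound R sound i) (⇓-sound R sound d)))) s t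
    ...   | inj₂ (inj₂ p) = complete-with af R sound cov (⇓-irreducible R sound c) p
            (∼-trans (∼-sym (⇓-sound R sound c))
              (∼-trans (obligation-sound R sound i) (⇓-sound R sound d))) s t

    -- At a leaf all monomials are related, in particular `a` and `0#`. So `a` would be reducible or
    -- equal to `0#`, but it is irreducible and has `b` below it.
    complete-with (now p) R sound cov {a} {b} irr b<a _ with cov a 0# (p a 0#)
    ... | inj₁ a≼0 = ⊥-elim (≮0 (<-resp ≈-refl (≼0⇒≈0 a≼0) b<a))
    ... | inj₂ red = ⊥-elim (irr red)
    complete-with (later p) R sound cov {a} {b} irr b<a a∼b =
      complete (p a) ((a , b) ∷ R) ((b<a , a∼b) ∷ sound) λ where
        y z (inj₁ q) → [ inj₁ , inj₂ ∘ there ]′ (cov y z q)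
        y z (inj₂ q) → inj₂ ([ here , ⊥-elim ∘ irr ]′ (cov a y q))

    congruence-decidable : ∀ s t → Dec (s ∼ t)
    congruence-decidable = complete ≼-af [] [] λ _ _ → inj₁

-- Monomials as multisets of variables

module Variables (d : ℕ) where
  open MonomialSystem

  Mono : ℕ → Set
  Mono m = X (sys d m)

  Var : ℕ → Set
  Var m = Vec ℕ m × Fin d

  ++-interchange : ∀ {A : Set} (as bs cs ds : List A) →
    (as ++ bs) ++ (cs ++ ds) ↭ (as ++ cs) ++ (bs ++ ds)
  ++-interchange {A} = CommutativeSemigroupProperties.interchange
    (CommutativeMonoid.commutativeSemigroup (++-commutativeMonoid {A = A}))

  unit : ∀ {d} → Fin d → Vec ℕ d
  unit zero    = 1 ∷ Base.0#
  unit (suc p) = 0 ∷ unit p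

  single : ∀ m → Var m → Mono m
  single zero    ([] , p)        = unit p
  single (suc m) (zero ∷ w , p)  = [ single m (w , p) ]
  single (suc m) (suc q ∷ w , p) = 0# (sys d m) ∷ single (suc m) (q ∷ w , p)

  encode : ∀ m → List (Var m) → Mono m
  encode m = foldr (λ v → _+_ (sys d m) (single m v)) (0# (sys d m))

  module _ {m : ℕ} where
    private
      module M = MonomialSystem (sys d m)

    encode-++ : ∀ us vs → encode m (us ++ vs) M.≈ encode m us M.+ encode m vs
    encode-++ []       vs = M.≈-sym (M.identityˡ _)
    encode-++ (u ∷ us) vs =
      M.≈-trans (M.∙-cong M.≈-refl (encode-++ us vs)) (M.≈-sym (M.assoc _ _ _))

    encode-↭ : ∀ {us vs} → us ↭ vs → encode m us M.≈ encode m vs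
    encode-↭ _↭_.refl         = M.≈-refl
    encode-↭ (_↭_.prep u p)   = M.∙-cong M.≈-refl (encode-↭ p)
    encode-↭ (_↭_.swap u v p) = M.≈-trans (M.∙-cong M.≈-refl (M.∙-cong M.≈-refl (encode-↭ p)))
      (M.≈-trans (M.≈-sym (M.assoc _ _ _))
        (M.≈-trans (M.∙-cong (M.comm _ _) M.≈-refl) (M.assoc _ _ _)))
    encode-↭ (_↭_.trans p q)  = M.≈-trans (encode-↭ p) (encode-↭ q)

  places : ∀ {d} → Vec ℕ d → List (Fin d)
  places []      = []
  places (n ∷ v) = replicate n zero ++ map suc (places v)

  places-0 : ∀ {d} → places (Base.0# {d}) ≡ []
  places-0 {zero}  = refl
  places-0 {suc d} = cong (map suc) (places-0 {d})

  replicate-+ : ∀ {A : Set} m n (x : A) → replicate (m ℕ.+ n) x ≡ replicate m x ++ replicate n x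
  replicate-+ zero    n x = refl
  replicate-+ (suc m) n x = cong (x ∷_) (replicate-+ m n x)

  places-+ : ∀ {d} (v w : Vec ℕ d) → places (v Base.+ w) ↭ places v ++ places w
  places-+ []      []      = ↭-refl
  places-+ (m ∷ v) (n ∷ w) = ↭-trans
    (++⁺ (↭-reflexive (replicate-+ m n zero))
         (↭-trans (map⁺ suc (places-+ v w)) (↭-reflexive (map-++ suc (places v) (places w)))))
    (++-interchange (replicate m zero) _ _ _)

  places-unit : ∀ {d} (p : Fin d) → places (unit p) ≡ [ p ]
  places-unit {suc d} zero = cong (λ l → zero ∷ map suc l) (places-0 {d})
  places-unit (suc p) = cong (map suc) (places-unit p)

  first : ∀ {m} → Var m → Var (suc m)
  first (w , p) = zero ∷ w , p

  bump : ∀ {m} → Var (suc m) → Var (suc m)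
  bump (q ∷ w , p) = suc q ∷ w , p

  decode : ∀ m → Mono m → List (Var m)
  decode zero    v        = map ([] ,_) (places v)
  decode (suc m) []       = []
  decode (suc m) (x ∷ xs) = map first (decode m x) ++ map bump (decode (suc m) xs)

  decode-0 : ∀ m → decode m (0# (sys d m)) ≡ []
  decode-0 zero    = cong (map ([] ,_)) (places-0 {d})
  decode-0 (suc m) = refl

  decode-≈ : ∀ m {x y} → _≈_ (sys d m) x y → decode m x ↭ decode m y
  decode-≈ zero refl = ↭-refl
  decode-≈ (suc m) {xs} {ys} p = go xs ys (Lift.at-≈ p)
    where
    open Lift (sys d m) using (at)
    zero-first : ∀ {x} → _≈_ (sys d m) (0# (sys d m)) x → [] ↭ map first (decode m x)
    zero-first {x} p = ↭-trans (↭-reflexive (cong (map first) (sym (decode-0 m)))) (map⁺ first (decode-≈ m p))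
    go : ∀ xs ys → (∀ n → _≈_ (sys d m) (at xs n) (at ys n)) → decode (suc m) xs ↭ decode (suc m) ys
    go [] [] p = ↭-refl
    go [] (y ∷ ys) p = ++⁺ (zero-first (p 0)) (map⁺ bump (go [] ys (λ n → p (suc n))))
    go (x ∷ xs) [] p = ↭-sym (++⁺ (zero-first (≈-sym (sys d m) (p 0)))
      (map⁺ bump (↭-sym (go xs [] (λ n → p (suc n))))))
    go (x ∷ xs) (y ∷ ys) p = ++⁺ (map⁺ first (decode-≈ m (p 0))) (map⁺ bump (go xs ys (λ n → p (suc n))))

  decode-+ : ∀ m x y → decode m (_+_ (sys d m) x y) ↭ decode m x ++ decode m y
  decode-+ zero v w = ↭-trans (map⁺ ([] ,_) (places-+ v w))
    (↭-reflexive (map-++ ([] ,_) (places v) (places w)))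
  decode-+ (suc m) = go
    where
    module M = MonomialSystem (sys d m)
    step : ∀ {z x y zs xs ys} → decode m z ↭ decode m x ++ decode m y →
      zs ↭ xs ++ ys →
      map first (decode m z) ++ map bump zs ↭
        (map first (decode m x) ++ map bump xs) ++ (map first (decode m y) ++ map bump ys)
    step {z} {x} {y} {zs} {xs} {ys} p q = ↭-trans
      (++⁺ (↭-trans (map⁺ first p) (↭-reflexive (map-++ first (decode m x) (decode m y))))
           (↭-trans (map⁺ bump q) (↭-reflexive (map-++ bump xs ys))))
      (++-interchange (map first (decode m x)) _ _ _)
    drop-0ˡ : ∀ l → map first (decode m M.0#) ++ l ≡ l
    drop-0ˡ l rewrite decode-0 m = refl
    go : ∀ xs ys → decode (suc m) (_+_ (sys d (suc m)) xs ys) ↭ decode (suc m) xs ++ decode (suc m) ys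
    go [] [] = ↭-refl
    go [] (y ∷ ys) = ↭-trans (step {x = M.0#} {xs = []} (decode-+ m M.0# y) (go [] ys))
      (↭-reflexive (cong (λ l → (l ++ []) ++ decode (suc m) (y ∷ ys)) (cong (map first) (decode-0 m))))
    go (x ∷ xs) [] = ↭-trans (step {y = M.0#} {ys = []} (decode-+ m x M.0#) (go xs []))
      (↭-reflexive (cong (λ l → decode (suc m) (x ∷ xs) ++ (l ++ [])) (cong (map first) (decode-0 m))))
    go (x ∷ xs) (y ∷ ys) = step (decode-+ m x y) (go xs ys)

  decode-single : ∀ m v → decode m (single m v) ≡ [ v ]
  decode-single zero    ([] , p)        = cong (map ([] ,_)) (places-unit p)
  decode-single (suc m) (zero ∷ w , p)  = cong (λ l → map first l ++ []) (decode-single m (w , p))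
  decode-single (suc m) (suc q ∷ w , p) = cong₂ (λ k l → map first k ++ map bump l)
    (decode-0 m) (decode-single (suc m) (q ∷ w , p))

  decode-encode : ∀ m vs → decode m (encode m vs) ↭ vs
  decode-encode m []       = ↭-reflexive (decode-0 m)
  decode-encode m (v ∷ vs) = ↭-trans (decode-+ m (single m v) (encode m vs))
    (++⁺ (↭-reflexive (decode-single m v)) (decode-encode m vs))

  position : {A : Set} → List (Maybe A) → ℕ → ℕ
  position []            q       = q
  position (nothing ∷ ι) q       = suc (position ι q)
  position (just _ ∷ ι)  zero    = zero
  position (just _ ∷ ι)  (suc q) = suc (position ι q)

  component : {A : Set} → A → List (Maybe A) → ℕ → A
  component i []            q       = i
  component i (nothing ∷ ι) q       = component i ι q
  component i (just e ∷ ι)  zero    = e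
  component i (just e ∷ ι)  (suc q) = component i ι q

  -- A wreath-product action: `ι` moves the leading coordinate, whose old value selects the
  -- embedding applied to the remaining ones.
  rename : ∀ m → E (sys d m) → Vec ℕ m → Vec ℕ m
  rename zero    e []      = []
  rename (suc m) ι (q ∷ w) = position ι q ∷ rename m (component (idE (sys d m)) ι q) w

  rename-id : ∀ m w → rename m (idE (sys d m)) w ≡ w
  rename-id zero    []      = refl
  rename-id (suc m) (q ∷ w) = cong (q ∷_) (rename-id m w)

  app-single : ∀ m e w p →
    _≈_ (sys d m) (app (sys d m) e (single m (w , p))) (single m (rename m e w , p))
  app-single zero    e [] p = refl
  app-single (suc m) ι (q ∷ w) p = go ι q
    where
    open Lift (sys d m)
    go : ∀ ι q → appᴸ ι (single (suc m) (q ∷ w , p)) ≈ᴸ single (suc m) (rename (suc m) ι (q ∷ w) , p)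
    go []            q       rewrite rename-id m w = ≈ᴸ-refl
    go (nothing ∷ ι) q       = ∷-≈ (≈-refl (sys d m)) (go ι q)
    go (just e ∷ ι)  zero    = ∷-≈ (app-single m e w p) (appᴸ-0 ι)
    go (just e ∷ ι)  (suc q) = ∷-≈ (app-0 (sys d m) e) (go ι q)

  app-encode : ∀ m e vs →
    _≈_ (sys d m) (app (sys d m) e (encode m vs)) (encode m (map (map₁ (rename m e)) vs))
  app-encode m e []             = app-0 (sys d m) e
  app-encode m e ((w , p) ∷ vs) = ≈-trans (sys d m) (app-+ (sys d m) e _ _)
    (∙-cong (sys d m) (app-single m e w p) (app-encode m e vs))

-- Embeddings of lexicographic powers of ℚ

data Order : Set where
  less equal greater : Order

order : {A B C : Set} → Tri A B C → Order
order (tri< _ _ _) = less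
order (tri≈ _ _ _) = equal
order (tri> _ _ _) = greater

module _ {A B C : Set} where

  order-< : (t : Tri A B C) → A → order t ≡ less
  order-< (tri< _ _ _)  a = refl
  order-< (tri≈ ¬a _ _) a = ⊥-elim (¬a a)
  order-< (tri> ¬a _ _) a = ⊥-elim (¬a a)

  order-≡ : (t : Tri A B C) → B → order t ≡ equal
  order-≡ (tri< _ ¬b _) b = ⊥-elim (¬b b)
  order-≡ (tri≈ _ _ _)  b = refl
  order-≡ (tri> _ ¬b _) b = ⊥-elim (¬b b)

  order-> : (t : Tri A B C) → C → order t ≡ greater
  order-> (tri< _ _ ¬c) c = ⊥-elim (¬c c)
  order-> (tri≈ _ _ ¬c) c = ⊥-elim (¬c c)
  order-> (tri> _ _ _)  c = refl

  order-≡⁻ : (t : Tri A B C) → order t ≡ equal → B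
  order-≡⁻ (tri≈ _ b _) _ = b

cmpℚ : ℚ → ℚ → Order
cmpℚ a b = order (ℚ.<-cmp a b)

cmpℕ : ℕ → ℕ → Order
cmpℕ a b = order (ℕ.<-cmp a b)

cmpℚ-refl : ∀ a → cmpℚ a a ≡ equal
cmpℚ-refl a = order-≡ (ℚ.<-cmp a a) refl

-- Position, in the tree of prefixes, at which two vectors part, and in which direction.
data TreeOrder : Set where
  same less greater : TreeOrder
  deeper : TreeOrder → TreeOrder

infixr 5 _◁_
_◁_ : Order → TreeOrder → TreeOrder
less    ◁ c = less
equal   ◁ c = deeper c
greater ◁ c = greater

cmpTree : ∀ {ℓ} → Vec ℚ ℓ → Vec ℚ ℓ → TreeOrder
cmpTree []      []      = same
cmpTree (a ∷ x) (b ∷ y) = cmpℚ a b ◁ cmpTree x y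

◁-injectiveˡ : ∀ {o o′ c c′} → o ◁ c ≡ o′ ◁ c′ → o ≡ o′
◁-injectiveˡ {less}    {less}    _ = refl
◁-injectiveˡ {equal}   {equal}   _ = refl
◁-injectiveˡ {greater} {greater} _ = refl

◁-injectiveʳ : ∀ {c c′} → equal ◁ c ≡ equal ◁ c′ → c ≡ c′
◁-injectiveʳ refl = refl

◁-cong : ∀ {o o′ c c′} → o ≡ o′ → (o ≡ equal → c ≡ c′) → o ◁ c ≡ o′ ◁ c′
◁-cong {less}    refl p = refl
◁-cong {equal}   refl p = cong deeper (p refl)
◁-cong {greater} refl p = refl

RelV : ∀ {ℓ} → Fin ℓ → Vec ℚ ℓ → Vec ℚ ℓ → Set
RelV zero    (a ∷ x) (b ∷ y) = a ℚ.≤ b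
RelV (suc i) (a ∷ x) (b ∷ y) = a ≡ b × RelV i x y

RelQ⇒RelV : ∀ {ℓ d} i {x y} {p q : Fin d} → RelQ {ℓ} i (x , p) (y , q) → RelV i x y
RelQ⇒RelV zero    {_ ∷ _} {_ ∷ _} (_ , r) = r
RelQ⇒RelV (suc i) {_ ∷ _} {_ ∷ _} {p} {q} (e , r) =
  e zero (ℕ.s≤s ℕ.z≤n) , RelQ⇒RelV i {_} {_} {p} {q} ((λ j j<i → e (suc j) (ℕ.s≤s j<i)) , r)

RelV⇒RelQ : ∀ {ℓ d} i {x y} {p q : Fin d} → RelV i x y → RelQ {ℓ} i (x , p) (y , q)
RelV⇒RelQ zero    {_ ∷ _} {_ ∷ _} r = (λ _ ()) , r
RelV⇒RelQ (suc i) {_ ∷ _} {_ ∷ _} {p} {q} (e , r) =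
  let es , r′ = RelV⇒RelQ i {p = p} {q} r in
  (λ { zero _ → e ; (suc j) (ℕ.s≤s j<i) → es j j<i }) , r′

cmpTree⇒RelV : ∀ {ℓ} (i : Fin ℓ) {x y x′ y′ : Vec ℚ ℓ} →
  cmpTree x y ≡ cmpTree x′ y′ → RelV i x y → RelV i x′ y′
cmpTree⇒RelV zero {a ∷ x} {b ∷ y} {a′ ∷ x′} {b′ ∷ y′} e r
  with ℚ.<-cmp a b | ℚ.<-cmp a′ b′
... | tri< _ _ _ | tri< p _ _   = ℚ.<⇒≤ p
... | tri≈ _ _ _ | tri≈ _ refl _ = ℚ.≤-refl
... | tri> _ _ p | _            = ⊥-elim (ℚ.<-irrefl refl (ℚ.<-≤-trans p r))
cmpTree⇒RelV (suc i) {a ∷ x} {b ∷ y} {a′ ∷ x′} {b′ ∷ y′} e (refl , r)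
  with ℚ.<-cmp a a | ℚ.<-cmp a′ b′
... | tri< p _ _ | _            = ⊥-elim (ℚ.<-irrefl refl p)
... | tri> _ _ p | _            = ⊥-elim (ℚ.<-irrefl refl p)
... | tri≈ _ _ _ | tri≈ _ p _   = p , cmpTree⇒RelV i (◁-injectiveʳ e) r

-- The relations only express `≤` below a common prefix. A strict comparison is recovered by
-- totality from the relation with the arguments exchanged, hence the two assumptions.
RelV⇒cmpTree : ∀ {ℓ} {x y x′ y′ : Vec ℚ ℓ} →
  (∀ i → (RelV i x y → RelV i x′ y′) × (RelV i x′ y′ → RelV i x y)) →
  (∀ i → (RelV i y x → RelV i y′ x′) × (RelV i y′ x′ → RelV i y x)) →
  cmpTree x y ≡ cmpTree x′ y′
RelV⇒cmpTree {x = []} {[]} {[]} {[]} f g = refl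
RelV⇒cmpTree {x = a ∷ x} {b ∷ y} {a′ ∷ x′} {b′ ∷ y′} f g =
  ◁-cong heads (λ e → tails (order-≡⁻ (ℚ.<-cmp a b) e) (order-≡⁻ (ℚ.<-cmp a′ b′) (trans (sym heads) e)))
  where
  strict : ∀ {a b a′ b′ : ℚ} → (b′ ℚ.≤ a′ → b ℚ.≤ a) → a ℚ.< b → a′ ℚ.< b′
  strict g p = ℚ.≰⇒> λ q → ℚ.<-irrefl refl (ℚ.<-≤-trans p (g q))
  heads : cmpℚ a b ≡ cmpℚ a′ b′
  heads with ℚ.<-cmp a b
  ... | tri< p _ _ = sym (order-< (ℚ.<-cmp a′ b′) (strict (proj₂ (g zero)) p))
  ... | tri> _ _ p = sym (order-> (ℚ.<-cmp a′ b′) (strict (proj₂ (f zero)) p))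
  ... | tri≈ _ p _ = sym (order-≡ (ℚ.<-cmp a′ b′) (ℚ.≤-antisym
        (proj₁ (f zero) (ℚ.≤-reflexive p)) (proj₁ (g zero) (ℚ.≤-reflexive (sym p)))))
  tails : a ≡ b → a′ ≡ b′ → cmpTree x y ≡ cmpTree x′ y′
  tails refl refl = RelV⇒cmpTree
    (λ i → (λ r → proj₂ (proj₁ (f (suc i)) (refl , r))) , (λ r → proj₂ (proj₂ (f (suc i)) (refl , r))))
    (λ i → (λ r → proj₂ (proj₁ (g (suc i)) (refl , r))) , (λ r → proj₂ (proj₂ (g (suc i)) (refl , r))))

cmpTree⇒≡ : ∀ {ℓ} {x y x′ y′ : Vec ℚ ℓ} → cmpTree x y ≡ cmpTree x′ y′ → x ≡ y → x′ ≡ y′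
cmpTree⇒≡ {x′ = []} {[]} _ _ = refl
cmpTree⇒≡ {x = a ∷ x} {.a ∷ .x} {a′ ∷ x′} {b′ ∷ y′} e refl =
  let o = trans (sym (◁-injectiveˡ e)) (cmpℚ-refl a) in
  cong₂ _∷_ (order-≡⁻ (ℚ.<-cmp a′ b′) o)
    (cmpTree⇒≡ {x = x} (◁-injectiveʳ (trans (cong (_◁ cmpTree x x) (sym (cmpℚ-refl a)))
      (trans e (cong (_◁ cmpTree x′ y′) o)))) refl)

-- Induction from the bottom gives `i ≤ f i`; induction from the top, where finiteness enters, gives
-- `f i ≤ i`.
strictMono⇒id : ∀ {d} (f : Fin d → Fin d) → (∀ {i j} → i Fin.< j → f i Fin.< f j) → ∀ i → f i ≡ i
strictMono⇒id {d} f mono i =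
  Fin.toℕ-injective (ℕ.≤-antisym (upper (d ℕ.∸ toℕ i) i refl) (lower (toℕ i) i refl))
  where
  lower : ∀ n i → toℕ i ≡ n → toℕ i ℕ.≤ toℕ (f i)
  lower zero    i e = subst (ℕ._≤ toℕ (f i)) (sym e) ℕ.z≤n
  lower (suc n) i e = subst (ℕ._≤ toℕ (f i)) (sym e)
    (ℕ.≤-<-trans (subst (ℕ._≤ toℕ (f j)) j≡n (lower n j j≡n)) (mono (ℕ.≤-reflexive (trans (cong suc j≡n) (sym e)))))
    where
    n<d : n ℕ.< d
    n<d = ℕ.<-trans (ℕ.≤-reflexive (sym e)) (Fin.toℕ<n i)
    j = Fin.fromℕ< n<d
    j≡n = Fin.toℕ-fromℕ< n<d
  upper : ∀ n i → d ℕ.∸ toℕ i ≡ n → toℕ (f i) ℕ.≤ toℕ i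
  upper n i e with suc (toℕ i) ℕ.<? d
  upper n i e | no ¬p = ℕ.≤-pred (ℕ.≤-trans (Fin.toℕ<n (f i)) (ℕ.≮⇒≥ ¬p))
  upper zero i e | yes p = ⊥-elim (ℕ.<-irrefl refl (ℕ.<-≤-trans (Fin.toℕ<n i) (ℕ.m∸n≡0⇒m≤n e)))
  upper (suc n) i e | yes p = ℕ.≤-pred (ℕ.<-≤-trans (mono i<j) (ℕ.≤-trans (upper n j e′) (ℕ.≤-reflexive j≡)))
    where
    j = Fin.fromℕ< p
    j≡ = Fin.toℕ-fromℕ< p
    i<j : i Fin.< j
    i<j = ℕ.≤-reflexive (sym j≡)
    e′ : d ℕ.∸ toℕ j ≡ n
    e′ = trans (cong (d ℕ.∸_) j≡) (ℕ.suc-injective (trans (sym (ℕ.+-∸-assoc 1 (ℕ.<⇒≤ p))) e))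

module _ {ℓ d : ℕ} {ι : Elem ℓ d → Elem ℓ d} (emb : IsEmb ℓ d ι) where

  emb⇒cmpTree : ∀ u v → cmpTree (proj₁ (ι u)) (proj₁ (ι v)) ≡ cmpTree (proj₁ u) (proj₁ v)
  emb⇒cmpTree u v = sym (RelV⇒cmpTree (rel u v) (rel v u))
    where
    rel : ∀ u v i → (RelV i (proj₁ u) (proj₁ v) → RelV i (proj₁ (ι u)) (proj₁ (ι v))) ×
                    (RelV i (proj₁ (ι u)) (proj₁ (ι v)) → RelV i (proj₁ u) (proj₁ v))
    rel u v i =
      (λ r → RelQ⇒RelV i {p = proj₂ (ι u)} {proj₂ (ι v)}
        (proj₁ (proj₁ emb i u v) (RelV⇒RelQ i {p = proj₂ u} {proj₂ v} r))) ,
      (λ r → RelQ⇒RelV i {p = proj₂ u} {proj₂ v}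
        (proj₂ (proj₁ emb i u v) (RelV⇒RelQ i {p = proj₂ (ι u)} {proj₂ (ι v)} r)))

  -- For fixed `x`, preserving and reflecting `RelD` makes the place of `ι (x , p)` strictly
  -- increasing in `p`, and a finite chain has no strictly increasing self-map but the identity.
  emb⇒place : ∀ x p → proj₂ (ι (x , p)) ≡ p
  emb⇒place x = strictMono⇒id (λ p → proj₂ (ι (x , p))) λ {p} {q} p<q →
    let x≡ , _ = proj₁ (proj₂ emb (x , p) (x , q)) (refl , ℕ.<⇒≤ p<q) in
    ℕ.≰⇒> λ q≤p → ℕ.<-irrefl refl (ℕ.<-≤-trans p<q
      (proj₂ (proj₂ (proj₂ emb (x , q) (x , p)) (sym x≡ , q≤p))))

cmpTree⇒emb : ∀ {ℓ d} (θ : Vec ℚ ℓ → Vec ℚ ℓ) → (∀ x y → cmpTree (θ x) (θ y) ≡ cmpTree x y) →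
  IsEmb ℓ d (λ { (x , p) → θ x , p })
cmpTree⇒emb {ℓ} θ h =
  (λ { i (x , p) (y , q) →
    (λ r → RelV⇒RelQ i {θ x} {θ y} {p} {q} (cmpTree⇒RelV i (sym (h x y)) (RelQ⇒RelV i {x} {y} {p} {q} r))) ,
    (λ r → RelV⇒RelQ i {x} {y} {p} {q} (cmpTree⇒RelV i (h x y) (RelQ⇒RelV i {θ x} {θ y} {p} {q} r))) }) ,
  (λ { (x , p) (y , q) →
    (λ { (e , r) → cong θ e , r }) , (λ { (e , r) → cmpTree⇒≡ (h x y) e , r }) })

-- Extension of finite partial isomorphisms of ℚ and of its lexicographic powers

StrictMono : (ℚ → ℚ) → Set
StrictMono f = ∀ {a b} → a ℚ.< b → f a ℚ.< f b

strictMono⇒cmpℚ : ∀ {f} → StrictMono f → ∀ a b → cmpℚ (f a) (f b) ≡ cmpℚ a b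
strictMono⇒cmpℚ {f} mono a b with ℚ.<-cmp a b
... | tri< p _ _    = order-< (ℚ.<-cmp (f a) (f b)) (mono p)
... | tri≈ _ refl _ = cmpℚ-refl (f a)
... | tri> _ _ p    = order-> (ℚ.<-cmp (f a) (f b)) (mono p)

glue : ℚ → (ℚ → ℚ) → (ℚ → ℚ) → ℚ → ℚ
glue c f g x with x ℚ.≤? c
... | yes _ = f x
... | no _  = g x

glue-≤ : ∀ {c f g x} → x ℚ.≤ c → glue c f g x ≡ f x
glue-≤ {c} {x = x} p with x ℚ.≤? c
... | yes _ = refl
... | no ¬p = ⊥-elim (¬p p)

glue-> : ∀ {c f g x} → c ℚ.< x → glue c f g x ≡ g x
glue-> {c} {x = x} p with x ℚ.≤? c
... | yes q = ⊥-elim (ℚ.<-irrefl refl (ℚ.<-≤-trans p q))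
... | no _  = refl

glue-mono : ∀ {c f g} → StrictMono f → StrictMono g → f c ≡ g c → StrictMono (glue c f g)
glue-mono {c} {f} {g} mf mg e {a} {b} p with a ℚ.≤? c | b ℚ.≤? c
... | yes _   | yes _   = mf p
... | no a≰c  | yes b≤c = ⊥-elim (a≰c (ℚ.<⇒≤ (ℚ.<-≤-trans p b≤c)))
... | no _    | no _    = mg p
... | yes a≤c | no b≰c with ℚ.<-cmp a c
...   | tri< a<c _ _  = ℚ.<-trans (mf a<c) (subst (ℚ._< g b) (sym e) (mg (ℚ.≰⇒> b≰c)))
...   | tri≈ _ refl _ = subst (ℚ._< g b) (sym e) (mg (ℚ.≰⇒> b≰c))
...   | tri> _ _ c<a  = ⊥-elim (ℚ.<-irrefl refl (ℚ.<-≤-trans c<a a≤c))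

p<q⇒0<q-p : ∀ {p q} → p ℚ.< q → 0ℚ ℚ.< q ℚ.- p
p<q⇒0<q-p {p} {q} p<q = subst (ℚ._< q ℚ.- p) (ℚ.+-inverseʳ p) (ℚ.+-monoˡ-< (ℚ.- p) p<q)

affine : ∀ {p p′ q q′} → p ℚ.< p′ → q ℚ.< q′ → ∃ λ f → StrictMono f × f p ≡ q × f p′ ≡ q′
affine {p} {p′} {q} {q′} p<p′ q<q′ = (λ x → q ℚ.+ k ℚ.* (x ℚ.- p)) ,
  (λ a<b → ℚ.+-monoʳ-< q (ℚ.*-monoʳ-<-pos k (ℚ.+-monoˡ-< (ℚ.- p) a<b))) ,
  trans (cong (λ r → q ℚ.+ k ℚ.* r) (ℚ.+-inverseʳ p)) (trans (cong (q ℚ.+_) (ℚ.*-zeroʳ k)) (ℚ.+-identityʳ q)) ,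
  (begin
    q ℚ.+ (q′ ℚ.- q) ℚ.* ℚ.1/ r ℚ.* r    ≡⟨ cong (q ℚ.+_) (ℚ.*-assoc (q′ ℚ.- q) (ℚ.1/ r) r) ⟩
    q ℚ.+ (q′ ℚ.- q) ℚ.* (ℚ.1/ r ℚ.* r)  ≡⟨ cong (λ s → q ℚ.+ (q′ ℚ.- q) ℚ.* s) (ℚ.*-inverseˡ r) ⟩
    q ℚ.+ (q′ ℚ.- q) ℚ.* 1ℚ          ≡⟨ cong (q ℚ.+_) (ℚ.*-identityʳ (q′ ℚ.- q)) ⟩
    q ℚ.+ (q′ ℚ.- q)               ≡⟨ cong (q ℚ.+_) (ℚ.+-comm q′ (ℚ.- q)) ⟩
    q ℚ.+ (ℚ.- q ℚ.+ q′)             ≡⟨ ℚ.+-assoc q (ℚ.- q) q′ ⟨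
    (q ℚ.- q) ℚ.+ q′               ≡⟨ cong (ℚ._+ q′) (ℚ.+-inverseʳ q) ⟩
    0ℚ ℚ.+ q′                    ≡⟨ ℚ.+-identityˡ q′ ⟩
    q′                         ∎)
  where
  open ≡-Reasoning
  r = p′ ℚ.- p
  instance
    r-pos : ℚ.Positive r
    r-pos = ℚ.positive (p<q⇒0<q-p p<p′)
    r-nonZero : ℚ.NonZero r
    r-nonZero = ℚ.pos⇒nonZero r
    1/r-pos : ℚ.Positive (ℚ.1/ r)
    1/r-pos = ℚ.1/pos⇒pos r
    q-pos : ℚ.Positive (q′ ℚ.- q)
    q-pos = ℚ.positive (p<q⇒0<q-p q<q′)
  k = (q′ ℚ.- q) ℚ.* ℚ.1/ r
  instance
    k-pos : ℚ.Positive k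
    k-pos = ℚ.pos*pos⇒pos (q′ ℚ.- q) (ℚ.1/ r)

-- Piecewise affine: the segment from `a` to `z` is stretched onto that from `a` to `y`, the one
-- from `z` to `b` onto that from `y` to `b`. As nothing moves outside, values can be corrected one
-- at a time.
bump-map : ∀ {a b z y} → a ℚ.< z → a ℚ.< y → z ℚ.< b → y ℚ.< b →
  ∃ λ f → StrictMono f × f z ≡ y × (∀ x → x ℚ.≤ a → f x ≡ x) × (∀ x → b ℚ.≤ x → f x ≡ x)
bump-map {a} {b} {z} {y} a<z a<y z<b y<b =
  let f , f-mono , fa , fz = affine a<z a<y
      g , g-mono , gz , gb = affine z<b y<b
      h = glue b g id
      h-mono = glue-mono g-mono id gb
      hz = trans (glue-≤ (ℚ.<⇒≤ z<b)) gz
      k = glue z f h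
      k-mono = glue-mono f-mono h-mono (trans fz (sym hz))
      kz = trans (glue-≤ {z} {f} {h} ℚ.≤-refl) fz
      ka = trans (glue-≤ {z} {f} {h} (ℚ.<⇒≤ a<z)) fa
      fixed = λ x (b≤x : b ℚ.≤ x) → trans (glue-> (ℚ.<-≤-trans (ℚ.<-trans a<z z<b) b≤x))
        (trans (glue-> (ℚ.<-≤-trans z<b b≤x)) (h-fixed g gb b≤x))
  in glue a id k , glue-mono id k-mono (sym ka) , trans (glue-> a<z) kz ,
     (λ x → glue-≤ {a} {id} {k}) , fixed
  where
  h-fixed : ∀ g → g b ≡ b → ∀ {x} → b ℚ.≤ x → glue b g id x ≡ x
  h-fixed g gb {x} b≤x with x ℚ.≤? b
  ... | yes x≤b = trans (cong g (ℚ.≤-antisym x≤b b≤x)) (trans gb (ℚ.≤-antisym b≤x x≤b))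
  ... | no _    = refl

p<p+1 : ∀ p → p ℚ.< p ℚ.+ 1ℚ
p<p+1 p = subst (ℚ._< p ℚ.+ 1ℚ) (ℚ.+-identityʳ p) (ℚ.+-monoʳ-< p (ℚ.positive⁻¹ 1ℚ))

p-1<p : ∀ p → p ℚ.- 1ℚ ℚ.< p
p-1<p p = subst (p ℚ.- 1ℚ ℚ.<_) (ℚ.+-identityʳ p) (ℚ.+-monoʳ-< p (ℚ.negative⁻¹ (ℚ.- 1ℚ)))

gap-above : ∀ m (us : List ℚ) → ∃ λ b → m ℚ.< b × (∀ {u} → u ∈ us → m ℚ.< u → b ℚ.≤ u)
gap-above m [] = m ℚ.+ 1ℚ , p<p+1 m , λ ()
gap-above m (u ∷ us) with gap-above m us
... | b , m<b , h with m ℚ.<? u | b ℚ.≤? u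
...   | no m≮u  | _       = b , m<b , λ { (here refl) p → ⊥-elim (m≮u p) ; (there i) → h i }
...   | yes _   | yes b≤u = b , m<b , λ { (here refl) _ → b≤u ; (there i) → h i }
...   | yes m<u | no b≰u  = u , m<u , λ { (here refl) _ → ℚ.≤-refl
                                        ; (there i) p → ℚ.≤-trans (ℚ.<⇒≤ (ℚ.≰⇒> b≰u)) (h i p) }

gap-below : ∀ m (us : List ℚ) → ∃ λ a → a ℚ.< m × (∀ {u} → u ∈ us → u ℚ.< m → u ℚ.≤ a)
gap-below m [] = m ℚ.- 1ℚ , p-1<p m , λ ()
gap-below m (u ∷ us) with gap-below m us
... | a , a<m , h with u ℚ.<? m | u ℚ.≤? a
...   | no u≮m  | _       = a , a<m , λ { (here refl) p → ⊥-elim (u≮m p) ; (there i) → h i }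
...   | yes _   | yes u≤a = a , a<m , λ { (here refl) _ → u≤a ; (there i) → h i }
...   | yes u<m | no u≰a  = u , u<m , λ { (here refl) _ → ℚ.≤-refl
                                        ; (there i) p → ℚ.≤-trans (h i p) (ℚ.<⇒≤ (ℚ.≰⇒> u≰a)) }

-- Comparing alike with both ends, `u` lies outside the closed interval from `z` to `y`.
same-side : ∀ {z y u} {P : Set} → z ℚ.< y → cmpℚ u z ≡ cmpℚ u y → (u ℚ.< z → P) → (y ℚ.< u → P) → P
same-side {z} {y} {u} z<y e low high with ℚ.<-cmp u z | ℚ.<-cmp u y
... | tri< u<z _ _ | _            = low u<z
... | tri≈ _ u≡z _ | tri≈ _ u≡y _ = ⊥-elim (ℚ.<-irrefl (trans (sym u≡z) u≡y) z<y)
... | tri> _ _ _   | tri> _ _ y<u = high y<u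

move-point : ∀ z y (us : List ℚ) → (∀ {u} → u ∈ us → cmpℚ u z ≡ cmpℚ u y) →
  ∃ λ f → StrictMono f × f z ≡ y × (∀ {u} → u ∈ us → f u ≡ u)
move-point z y us h with ℚ.<-cmp z y
... | tri≈ _ z≡y _ = id , id , z≡y , λ _ → refl
... | tri< z<y _ _ =
  let a , a<z , below = gap-below z us
      b , y<b , above = gap-above y us
      f , mono , fz , low , high = bump-map a<z (ℚ.<-trans a<z z<y) (ℚ.<-trans z<y y<b) y<b
  in f , mono , fz , λ {u} i → same-side z<y (h i) (low u ∘ below i) (high u ∘ above i)
... | tri> _ _ y<z =
  let a , a<y , below = gap-below y us
      b , z<b , above = gap-above z us
      f , mono , fz , low , high = bump-map (ℚ.<-trans a<y y<z) a<y z<b (ℚ.<-trans y<z z<b)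
  in f , mono , fz , λ {u} i → same-side y<z (sym (h i)) (low u ∘ below i) (high u ∘ above i)

-- The points are treated one by one. The map `f` for the others is strictly monotone, so `f x` and
-- `y` compare alike with the values already attained, and `g` moves the one to the other while
-- fixing those values.
extend-ℚ : (zs : List (ℚ × ℚ)) →
  (∀ {z z′} → z ∈ zs → z′ ∈ zs → cmpℚ (proj₁ z) (proj₁ z′) ≡ cmpℚ (proj₂ z) (proj₂ z′)) →
  ∃ λ f → StrictMono f × (∀ {z} → z ∈ zs → f (proj₁ z) ≡ proj₂ z)
extend-ℚ [] _ = id , id , λ ()
extend-ℚ ((x , y) ∷ zs) h =
  let f , f-mono , f-ext = extend-ℚ zs (λ i j → h (there i) (there j))
      g , g-mono , g-moves , g-fixes = move-point (f x) y (map proj₂ zs) (λ i → position f f-mono f-ext (∈-map⁻ proj₂ i))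
  in g ∘ f , g-mono ∘ f-mono ,
     λ { (here refl) → g-moves
       ; (there i) → trans (cong g (f-ext i)) (g-fixes (∈-map⁺ proj₂ i)) }
  where
  position : ∀ f → StrictMono f → (∀ {z} → z ∈ zs → f (proj₁ z) ≡ proj₂ z) →
    ∀ {u} → (∃ λ z → z ∈ zs × u ≡ proj₂ z) → cmpℚ u (f x) ≡ cmpℚ u y
  position f mono ext (z , i , refl) =
    trans (cong (λ u → cmpℚ u (f x)) (sym (ext i)))
      (trans (strictMono⇒cmpℚ mono (proj₁ z) x) (h (there i) (here refl)))

module _ {K B : Set} (_≟_ : DecidableEquality K) where

  slice : K → List (K × B) → List B
  slice q [] = []
  slice q ((k , b) ∷ l) with q ≟ k
  ... | yes _ = b ∷ slice q l
  ... | no _  = slice q l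

  ∈-slice⁺ : ∀ {q b l} → (q , b) ∈ l → b ∈ slice q l
  ∈-slice⁺ {q} {l = (k , _) ∷ _} (here refl) with q ≟ k
  ... | yes _ = here refl
  ... | no ¬p = ⊥-elim (¬p refl)
  ∈-slice⁺ {q} {l = (k , _) ∷ _} (there i) with q ≟ k
  ... | yes _ = there (∈-slice⁺ i)
  ... | no _  = ∈-slice⁺ i

  ∈-slice⁻ : ∀ {q b} l → b ∈ slice q l → (q , b) ∈ l
  ∈-slice⁻ {q} ((k , _) ∷ l) i with q ≟ k
  ∈-slice⁻ ((k , _) ∷ l) (here refl) | yes refl = here refl
  ∈-slice⁻ ((k , _) ∷ l) (there i)   | yes _    = there (∈-slice⁻ l i)
  ∈-slice⁻ ((k , _) ∷ l) i           | no _     = there (∈-slice⁻ l i)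

-- Homogeneity of the tree of prefixes. `extend-ℚ` treats the first coordinates; then the remaining
-- ones are extended independently for each first coordinate `q`, because vectors that differ there
-- are compared no further.
extend : ∀ ℓ (zs : List (Vec ℚ ℓ × Vec ℚ ℓ)) →
  (∀ {z z′} → z ∈ zs → z′ ∈ zs → cmpTree (proj₁ z) (proj₁ z′) ≡ cmpTree (proj₂ z) (proj₂ z′)) →
  ∃ λ (θ : Vec ℚ ℓ → Vec ℚ ℓ) →
    (∀ x y → cmpTree (θ x) (θ y) ≡ cmpTree x y) × (∀ {z} → z ∈ zs → θ (proj₁ z) ≡ proj₂ z)
extend zero    zs h = id , (λ _ _ → refl) , λ { {[] , []} _ → refl }
extend (suc ℓ) zs h = θ , θ-cmp , θ-ext
  where
  Pair : Set
  Pair = Vec ℚ (suc ℓ) × Vec ℚ (suc ℓ)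
  heads : Pair → ℚ × ℚ
  heads (x , y) = head x , head y
  unconsˡ : Pair → ℚ × (Vec ℚ ℓ × Vec ℚ (suc ℓ))
  unconsˡ (x , y) = head x , tail x , y
  heads-compatible : ∀ {z z′} → z ∈ map heads zs → z′ ∈ map heads zs →
    cmpℚ (proj₁ z) (proj₁ z′) ≡ cmpℚ (proj₂ z) (proj₂ z′)
  heads-compatible i j with ∈-map⁻ heads i | ∈-map⁻ heads j
  ... | (_ ∷ _ , _ ∷ _) , i′ , refl | (_ ∷ _ , _ ∷ _) , j′ , refl = ◁-injectiveˡ (h i′ j′)
  f = extend-ℚ (map heads zs) heads-compatible
  under : ℚ → List (Vec ℚ ℓ × Vec ℚ (suc ℓ))
  under q = slice ℚ._≟_ q (map unconsˡ zs)
  under⁻ : ∀ {q x y} → (x , y) ∈ under q → (q ∷ x , y) ∈ zs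
  under⁻ {q} i with ∈-map⁻ unconsˡ (∈-slice⁻ ℚ._≟_ (map unconsˡ zs) i)
  ... | (_ ∷ _ , _) , j , refl = j
  tails : Vec ℚ ℓ × Vec ℚ (suc ℓ) → Vec ℚ ℓ × Vec ℚ ℓ
  tails (x , y) = x , tail y
  tails-compatible : ∀ q {z z′} → z ∈ map tails (under q) → z′ ∈ map tails (under q) →
    cmpTree (proj₁ z) (proj₁ z′) ≡ cmpTree (proj₂ z) (proj₂ z′)
  tails-compatible q i j with ∈-map⁻ tails i | ∈-map⁻ tails j
  ... | (x , b ∷ y) , i′ , refl | (x′ , b′ ∷ y′) , j′ , refl = ◁-injectiveʳ (begin
      equal ◁ cmpTree x x′      ≡⟨ cong (_◁ cmpTree x x′) (cmpℚ-refl q) ⟨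
      cmpℚ q q ◁ cmpTree x x′   ≡⟨ e ⟩
      cmpℚ b b′ ◁ cmpTree y y′  ≡⟨ cong (_◁ cmpTree y y′) (trans (sym (◁-injectiveˡ e)) (cmpℚ-refl q)) ⟩
      equal ◁ cmpTree y y′      ∎)
    where
    open ≡-Reasoning
    e : cmpℚ q q ◁ cmpTree x x′ ≡ cmpℚ b b′ ◁ cmpTree y y′
    e = h (under⁻ i′) (under⁻ j′)
  rec = λ q → extend ℓ (map tails (under q)) (tails-compatible q)
  θ : Vec ℚ (suc ℓ) → Vec ℚ (suc ℓ)
  θ (q ∷ x) = proj₁ f q ∷ proj₁ (rec q) x
  θ-cmp : ∀ x y → cmpTree (θ x) (θ y) ≡ cmpTree x y
  θ-cmp (q ∷ x) (r ∷ y) = ◁-cong heads≡ (λ e → deep (order-≡⁻ (ℚ.<-cmp q r) (trans (sym heads≡) e)))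
    where
    heads≡ = strictMono⇒cmpℚ (proj₁ (proj₂ f)) q r
    deep : q ≡ r → cmpTree (proj₁ (rec q) x) (proj₁ (rec r) y) ≡ cmpTree x y
    deep refl = proj₁ (proj₂ (rec q)) x y
  θ-ext : ∀ {z} → z ∈ zs → θ (proj₁ z) ≡ proj₂ z
  θ-ext {q ∷ x , b ∷ y} i = cong₂ _∷_ (proj₂ (proj₂ f) (∈-map⁺ heads i))
    (proj₂ (proj₂ (rec q)) (∈-map⁺ tails (∈-slice⁺ ℚ._≟_ (∈-map⁺ unconsˡ i))))

-- Coding finite parts of lexicographic powers of ℚ by natural numbers

_≟ᵀ_ : DecidableEquality TreeOrder
same     ≟ᵀ same     = yes refl
same     ≟ᵀ less     = no λ ()
same     ≟ᵀ greater  = no λ ()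
same     ≟ᵀ deeper _ = no λ ()
less     ≟ᵀ same     = no λ ()
less     ≟ᵀ less     = yes refl
less     ≟ᵀ greater  = no λ ()
less     ≟ᵀ deeper _ = no λ ()
greater  ≟ᵀ same     = no λ ()
greater  ≟ᵀ less     = no λ ()
greater  ≟ᵀ greater  = yes refl
greater  ≟ᵀ deeper _ = no λ ()
deeper _ ≟ᵀ same     = no λ ()
deeper _ ≟ᵀ less     = no λ ()
deeper _ ≟ᵀ greater  = no λ ()
deeper c ≟ᵀ deeper c′ with c ≟ᵀ c′
... | yes refl = yes refl
... | no c≢    = no λ { refl → c≢ refl }

infixr 6 _⨾_
_⨾_ : Order → Order → Order
less    ⨾ p = less
equal   ⨾ p = p
greater ⨾ p = greater

⨾-cong : ∀ {o o′ p p′} → o ≡ o′ → (o ≡ equal → p ≡ p′) → o ⨾ p ≡ o′ ⨾ p′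
⨾-cong {less}    refl h = refl
⨾-cong {equal}   refl h = h refl
⨾-cong {greater} refl h = refl

⨾-equal⁻ : ∀ o {p} → o ⨾ p ≡ equal → o ≡ equal × p ≡ equal
⨾-equal⁻ equal e = refl , e

cmpℕ-refl : ∀ i → cmpℕ i i ≡ equal
cmpℕ-refl i = order-≡ (ℕ.<-cmp i i) refl

strictMono⇒cmpℕ : ∀ (f : ℕ → ℕ) → (∀ {i j} → i ℕ.< j → f i ℕ.< f j) → ∀ i j → cmpℕ (f i) (f j) ≡ cmpℕ i j
strictMono⇒cmpℕ f mono i j with ℕ.<-cmp i j
... | tri< p _ _    = order-< (ℕ.<-cmp (f i) (f j)) (mono p)
... | tri≈ _ refl _ = cmpℕ-refl (f i)
... | tri> _ _ p    = order-> (ℕ.<-cmp (f i) (f j)) (mono p)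

double : ℕ → ℕ
double zero    = zero
double (suc ℓ) = suc (suc (double ℓ))

-- Consecutive pairs of coordinates, ordered lexicographically, play the role of one coordinate in ℚ.
cmpω : ∀ ℓ → Vec ℕ (double ℓ) → Vec ℕ (double ℓ) → TreeOrder
cmpω zero    []          []             = same
cmpω (suc ℓ) (i ∷ j ∷ v) (i′ ∷ j′ ∷ v′) = (cmpℕ i i′ ⨾ cmpℕ j j′) ◁ cmpω ℓ v v′

data _<ₗ_ : ℕ × ℕ → ℕ × ℕ → Set where
  first<  : ∀ {i j i′ j′} → i ℕ.< i′ → (i , j) <ₗ (i′ , j′)
  second< : ∀ {i j j′} → j ℕ.< j′ → (i , j) <ₗ (i , j′)

<ₗ⇒less : ∀ {i j i′ j′} → (i , j) <ₗ (i′ , j′) → cmpℕ i i′ ⨾ cmpℕ j j′ ≡ less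
<ₗ⇒less {i} {j} {i′} {j′} (first< p) = cong (_⨾ cmpℕ j j′) (order-< (ℕ.<-cmp i i′) p)
<ₗ⇒less {i} {j} {_} {j′} (second< p) =
  trans (cong (_⨾ cmpℕ j j′) (cmpℕ-refl i)) (order-< (ℕ.<-cmp j j′) p)

<ₗ⇒greater : ∀ {i j i′ j′} → (i′ , j′) <ₗ (i , j) → cmpℕ i i′ ⨾ cmpℕ j j′ ≡ greater
<ₗ⇒greater {i} {j} {i′} {j′} (first< p) = cong (_⨾ cmpℕ j j′) (order-> (ℕ.<-cmp i i′) p)
<ₗ⇒greater {i} {j} {_} {j′} (second< p) =
  trans (cong (_⨾ cmpℕ j j′) (cmpℕ-refl i)) (order-> (ℕ.<-cmp j j′) p)

floor : ℕ → ℚ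
floor zero    = 0ℚ
floor (suc i) = floor i ℚ.+ 1ℚ

floor-mono : ∀ {i i′} → i ℕ.≤ i′ → floor i ℚ.≤ floor i′
floor-mono {i′ = i′} p = go (ℕ.≤⇒≤′ p)
  where
  go : ∀ {i i′} → i ℕ.≤′ i′ → floor i ℚ.≤ floor i′
  go (ℕ.≤′-reflexive refl) = ℚ.≤-refl
  go (ℕ.≤′-step p) = ℚ.≤-trans (go p) (ℚ.<⇒≤ (p<p+1 _))

-- By density, an increasing sequence starting at the integer `i` stays below the next one. So the
-- copies of ω for successive `i` follow one another inside ℚ, which realises the order type of
-- pairs.
grid-below : ∀ i → ℕ → ∃ λ r → r ℚ.< floor (suc i)
grid-below i zero    = floor i , p<p+1 (floor i)
grid-below i (suc j) = let m , _ , m< = ℚ.<-dense (proj₂ (grid-below i j)) in m , m<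

grid : ℕ → ℕ → ℚ
grid i j = proj₁ (grid-below i j)

grid-monoʳ : ∀ i {j j′} → j ℕ.< j′ → grid i j ℚ.< grid i j′
grid-monoʳ i {j} {j′} p = go j j′ (ℕ.≤⇒≤′ p)
  where
  step : ∀ j → grid i j ℚ.< grid i (suc j)
  step j = proj₁ (proj₂ (ℚ.<-dense (proj₂ (grid-below i j))))
  go : ∀ j j′ → suc j ℕ.≤′ j′ → grid i j ℚ.< grid i j′
  go j _        (ℕ.≤′-reflexive refl) = step j
  go j (suc j′) (ℕ.≤′-step p)         = ℚ.<-trans (go j j′ p) (step j′)

floor≤grid : ∀ i j → floor i ℚ.≤ grid i j
floor≤grid i zero    = ℚ.≤-refl
floor≤grid i (suc j) = ℚ.<⇒≤ (grid-monoʳ i {0} {suc j} (s≤s z≤n))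

grid-mono : ∀ i j i′ j′ → (i , j) <ₗ (i′ , j′) → grid i j ℚ.< grid i′ j′
grid-mono i j i′ j′ (first< p) =
  ℚ.<-≤-trans (proj₂ (grid-below i j)) (ℚ.≤-trans (floor-mono p) (floor≤grid i′ j′))
grid-mono i j _ j′ (second< p) = grid-monoʳ i {j} {j′} p

cmp-grid : ∀ i j i′ j′ → cmpℚ (grid i j) (grid i′ j′) ≡ cmpℕ i i′ ⨾ cmpℕ j j′
cmp-grid i j i′ j′ with ℕ.<-cmp i i′
... | tri< p _ _ = order-< (ℚ.<-cmp (grid i j) (grid i′ j′)) (grid-mono i j i′ j′ (first< p))
... | tri> _ _ p = order-> (ℚ.<-cmp (grid i j) (grid i′ j′)) (grid-mono i′ j′ i j (first< p))
... | tri≈ _ refl _ with ℕ.<-cmp j j′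
...   | tri< p _ _    = order-< (ℚ.<-cmp (grid i j) (grid i j′)) (grid-monoʳ i {j} {j′} p)
...   | tri≈ _ refl _ = cmpℚ-refl (grid i j)
...   | tri> _ _ p    = order-> (ℚ.<-cmp (grid i j) (grid i j′)) (grid-monoʳ i {j′} {j} p)

embed : ∀ ℓ → Vec ℕ (double ℓ) → Vec ℚ ℓ
embed zero    []          = []
embed (suc ℓ) (i ∷ j ∷ v) = grid i j ∷ embed ℓ v

embed-cmp : ∀ ℓ v w → cmpTree (embed ℓ v) (embed ℓ w) ≡ cmpω ℓ v w
embed-cmp zero    []          []             = refl
embed-cmp (suc ℓ) (i ∷ j ∷ v) (i′ ∷ j′ ∷ w) = cong₂ _◁_ (cmp-grid i j i′ j′) (embed-cmp ℓ v w)

count : {P : ℚ → Set} → (∀ q → Dec (P q)) → List ℚ → ℕ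
count P? l = length (filter P? l)

module _ {P Q : ℚ → Set} (P? : ∀ q → Dec (P q)) (Q? : ∀ q → Dec (Q q)) (P⊆Q : ∀ {q} → P q → Q q) where

  count-mono : ∀ l → count P? l ℕ.≤ count Q? l
  count-mono [] = z≤n
  count-mono (x ∷ l) with P? x | Q? x
  ... | yes _ | yes _ = s≤s (count-mono l)
  ... | yes p | no ¬q = ⊥-elim (¬q (P⊆Q p))
  ... | no _  | yes _ = ℕ.m≤n⇒m≤1+n (count-mono l)
  ... | no _  | no _  = count-mono l

  count-strict : ∀ {x l} → x ∈ l → ¬ P x → Q x → count P? l ℕ.< count Q? l
  count-strict {x} {_ ∷ l} (here refl) ¬p q with P? x | Q? x
  ... | yes p | _     = ⊥-elim (¬p p)
  ... | no _  | yes _ = s≤s (count-mono l)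
  ... | no _  | no ¬q = ⊥-elim (¬q q)
  count-strict {x} {y ∷ l} (there i) ¬p q with P? y | Q? y
  ... | yes _  | yes _ = s≤s (count-strict i ¬p q)
  ... | yes p  | no ¬q = ⊥-elim (¬q (P⊆Q p))
  ... | no _   | yes _ = ℕ.m≤n⇒m≤1+n (count-strict i ¬p q)
  ... | no _   | no _  = count-strict i ¬p q

uncons : ∀ {A : Set} {m} → Vec A (suc m) → A × Vec A m
uncons (a ∷ x) = a , x

below : ∀ {ℓ} → ℚ → List (Vec ℚ (suc ℓ)) → List (Vec ℚ ℓ)
below q P = slice ℚ._≟_ q (map uncons P)

∈-below⁺ : ∀ {ℓ q P} {x : Vec ℚ ℓ} → (q ∷ x) ∈ P → x ∈ below q P
∈-below⁺ i = ∈-slice⁺ ℚ._≟_ (∈-map⁺ uncons i)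

∈-below⁻ : ∀ {ℓ q P} {x : Vec ℚ ℓ} → x ∈ below q P → (q ∷ x) ∈ P
∈-below⁻ {P = P} i with ∈-map⁻ uncons (∈-slice⁻ ℚ._≟_ (map uncons P) i)
... | _ ∷ _ , j , refl = j

-- The successor reserves `zero` for the points of `P`, which are the left ends of their intervals.
zero-if-inhabited : ∀ {A : Set} → List A → ℕ → ℕ
zero-if-inhabited []      n = suc n
zero-if-inhabited (_ ∷ _) n = zero

zero-if-inhabited-∈ : ∀ {A : Set} {x : A} {l} n → x ∈ l → zero-if-inhabited l n ≡ 0
zero-if-inhabited-∈ n (here _)  = refl
zero-if-inhabited-∈ n (there _) = refl

zero-if-inhabited-≤ : ∀ {A : Set} (l : List A) n → zero-if-inhabited l n ℕ.≤ suc n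
zero-if-inhabited-≤ []      n = ℕ.≤-refl
zero-if-inhabited-≤ (_ ∷ _) n = z≤n

column row : ∀ {ℓ} → List (Vec ℚ (suc ℓ)) → List (Vec ℚ (suc ℓ)) → ℚ → ℕ
column P F q = count (ℚ._≤? q) (map head P)
row    P F q = zero-if-inhabited (below q P) (count (ℚ._<? q) (map head F))

-- The points of P cut ℚ into intervals; a value is coded by the number of points of P up to it and
-- by its rank among the values in F, except that points of P always come first in their interval.
-- Thus the code of a point of P does not depend on F.
code : ∀ ℓ → List (Vec ℚ ℓ) → List (Vec ℚ ℓ) → Vec ℚ ℓ → Vec ℕ (double ℓ)
code zero    P F []      = []
code (suc ℓ) P F (q ∷ x) = column P F q ∷ row P F q ∷ code ℓ (below q P) (below q F) x

code-fixed : ∀ ℓ P F F′ {x} → x ∈ P → code ℓ P F x ≡ code ℓ P F′ x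
code-fixed zero    P F F′ {[]}    i = refl
code-fixed (suc ℓ) P F F′ {q ∷ x} i = cong (column P F q ∷_) (cong₂ _∷_
  (trans (zero-if-inhabited-∈ _ (∈-below⁺ i)) (sym (zero-if-inhabited-∈ _ (∈-below⁺ i))))
  (code-fixed ℓ (below q P) (below q F) (below q F′) (∈-below⁺ i)))

-- If `q′` occurs in `P`, it opens a new interval and the column grows. Otherwise, when the columns
-- agree, `q` is counted in the rank of `q′` but not in its own; this is where `q` must occur in
-- `F`.
code-mono : ∀ {ℓ} (P F : List (Vec ℚ (suc ℓ))) {q q′ x} → (q ∷ x) ∈ F → q ℚ.< q′ →
  (column P F q , row P F q) <ₗ (column P F q′ , row P F q′)
code-mono P F {q} {q′} i q<q′ with below q′ P in eq
... | y ∷ _ = first< (count-strict (ℚ._≤? q) (ℚ._≤? q′) (λ p → ℚ.≤-trans p (ℚ.<⇒≤ q<q′))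
        (∈-map⁺ head (∈-below⁻ {P = P} (subst (y ∈_) (sym eq) (here refl))))
        (λ p → ℚ.<-irrefl refl (ℚ.<-≤-trans q<q′ p)) ℚ.≤-refl)
... | [] with ℕ.m≤n⇒m<n∨m≡n (count-mono (ℚ._≤? q) (ℚ._≤? q′) (λ p → ℚ.≤-trans p (ℚ.<⇒≤ q<q′)) (map head P))
...   | inj₁ p = first< p
...   | inj₂ p rewrite p = second< (s≤s (ℕ.≤-trans (zero-if-inhabited-≤ (below q P) _)
        (count-strict (ℚ._<? q) (ℚ._<? q′) (λ p → ℚ.<-trans p q<q′) (∈-map⁺ head i)
          (ℚ.<-irrefl refl) q<q′)))

code-cmp : ∀ ℓ P F {x y} → x ∈ F → y ∈ F → cmpω ℓ (code ℓ P F x) (code ℓ P F y) ≡ cmpTree x y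
code-cmp zero    P F {[]}    {[]}    i j = refl
code-cmp (suc ℓ) P F {q ∷ x} {r ∷ y} i j with ℚ.<-cmp q r
... | tri< p _ _ = ◁-cong {c′ = same} (<ₗ⇒less (code-mono P F i p))
        λ e → contradiction (trans (sym (<ₗ⇒less (code-mono P F i p))) e) λ ()
... | tri> _ _ p = ◁-cong {c′ = same} (<ₗ⇒greater (code-mono P F j p))
        λ e → contradiction (trans (sym (<ₗ⇒greater (code-mono P F j p))) e) λ ()
... | tri≈ _ refl _ = ◁-cong {c′ = cmpTree x y}
        (cong₂ _⨾_ (cmpℕ-refl (column P F q)) (cmpℕ-refl (row P F q)))
        λ _ → code-cmp ℓ (below q P) (below q F) (∈-below⁺ i) (∈-below⁺ j)

-- Renamings of variables and their compression to bounded coordinates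

module Renaming (d : ℕ) where
  open Variables d
  open MonomialSystem

  position-mono : ∀ {A : Set} (ι : List (Maybe A)) {q q′} → q ℕ.< q′ → position ι q ℕ.< position ι q′
  position-mono []            p = p
  position-mono (nothing ∷ ι) p = s≤s (position-mono ι p)
  position-mono (just _ ∷ ι) {zero}  {suc q′} _       = s≤s z≤n
  position-mono (just _ ∷ ι) {suc q} {suc q′} (s≤s p) = s≤s (position-mono ι p)

  -- The embedding used on later coordinates depends on the earlier ones. Equal earlier coordinates
  -- select the same embedding, and unequal ones have already decided the comparison.
  rename-cmp : ∀ ℓ e v w → cmpω ℓ (rename (double ℓ) e v) (rename (double ℓ) e w) ≡ cmpω ℓ v w
  rename-cmp zero    e []          []             = refl
  rename-cmp (suc ℓ) e (i ∷ j ∷ v) (i′ ∷ j′ ∷ w) =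
    ◁-cong heads λ p → deep (⨾-equal⁻ (cmpℕ i i′) (trans (sym heads) p))
    where
    sub : ℕ → E (sys d (suc (double ℓ)))
    sub = component (idE (sys d (suc (double ℓ)))) e
    subsub : ℕ → ℕ → E (sys d (double ℓ))
    subsub i = component (idE (sys d (double ℓ))) (sub i)
    firsts : cmpℕ (position e i) (position e i′) ≡ cmpℕ i i′
    firsts = strictMono⇒cmpℕ (position e) (position-mono e) i i′
    seconds : cmpℕ i i′ ≡ equal → cmpℕ (position (sub i) j) (position (sub i′) j′) ≡ cmpℕ j j′
    seconds p rewrite order-≡⁻ (ℕ.<-cmp i i′) p =
      strictMono⇒cmpℕ (position (sub i′)) (position-mono (sub i′)) j j′
    heads = ⨾-cong firsts λ p → seconds (trans (sym firsts) p)
    deep : cmpℕ i i′ ≡ equal × cmpℕ j j′ ≡ equal →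
      cmpω ℓ (rename (double ℓ) (subsub i j) v) (rename (double ℓ) (subsub i′ j′) w) ≡ cmpω ℓ v w
    deep (p , q) rewrite order-≡⁻ (ℕ.<-cmp i i′) p | order-≡⁻ (ℕ.<-cmp j j′) q =
      rename-cmp ℓ (subsub i′ j′) v w

  bump-head : ∀ {m} → Vec ℕ (suc m) → Vec ℕ (suc m)
  bump-head (q ∷ w) = suc q ∷ w

  rename-nothing : ∀ m ι v → rename (suc m) (nothing ∷ ι) v ≡ bump-head (rename (suc m) ι v)
  rename-nothing m ι (q ∷ v) = refl

  rename-just : ∀ m e ι v → rename (suc m) (just e ∷ ι) (bump-head v) ≡ bump-head (rename (suc m) ι v)
  rename-just m e ι (q ∷ v) = refl

  module _ {B : Set} where

    lower : List (ℕ × B) → List (ℕ × B)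
    lower []                = []
    lower ((zero , b) ∷ l)  = lower l
    lower ((suc q , b) ∷ l) = (q , b) ∷ lower l

    ∈-lower⁺ : ∀ {q b l} → (suc q , b) ∈ l → (q , b) ∈ lower l
    ∈-lower⁺ {l = (suc _ , _) ∷ _} (here refl) = here refl
    ∈-lower⁺ {l = (zero , _) ∷ _}  (there i)   = ∈-lower⁺ i
    ∈-lower⁺ {l = (suc _ , _) ∷ _} (there i)   = there (∈-lower⁺ i)

    ∈-lower⁻ : ∀ {q b} l → (q , b) ∈ lower l → (suc q , b) ∈ l
    ∈-lower⁻ ((zero , _) ∷ l)  i           = there (∈-lower⁻ l i)
    ∈-lower⁻ ((suc _ , _) ∷ l) (here refl) = here refl
    ∈-lower⁻ ((suc _ , _) ∷ l) (there i)   = there (∈-lower⁻ l i)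

    length-lower : ∀ l → length (slice ℕ._≟_ 0 l) ℕ.+ length (lower l) ≡ length l
    length-lower []                = refl
    length-lower ((zero , b) ∷ l)  = cong suc (length-lower l)
    length-lower ((suc q , b) ∷ l) = trans (ℕ.+-suc _ _) (cong suc (length-lower l))

  Compressed : ∀ m → ℕ → List (Vec ℕ m) → Set
  Compressed m N ws = ∃₂ λ (e : E (sys d m)) (κ : Vec ℕ m → Vec ℕ m) →
    ∀ {w} → w ∈ ws → rename m e (κ w) ≡ w × VecAll.All (ℕ._≤ N) (κ w)

  compress : ∀ m N ws → length ws ℕ.≤ N → Compressed m N ws
  compress zero    N ws len = tt , id , λ { {[]} _ → refl , [] }
  compress (suc m) N ws len =
    let b , b-bound = bound ws
        ι , κ , h = go b N ws′ (λ i → b-bound (back i)) (subst (ℕ._≤ N) (sym (length-map uncons ws)) len)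
                      (subst (ℕ._≤ N) (sym (length-map uncons ws)) len)
    in ι , (λ w → κ (uncons w)) , λ { {q ∷ w} i →
      let e , p , ps = h (∈-map⁺ uncons i) in e , all (κ (q , w)) p ps }
    where
    ws′ = map uncons ws
    all : ∀ v → head v ℕ.≤ N → VecAll.All (ℕ._≤ N) (tail v) → VecAll.All (ℕ._≤ N) v
    all (_ ∷ _) p ps = p ∷ ps
    back : ∀ {q w} → (q , w) ∈ ws′ → (q ∷ w) ∈ ws
    back i with ∈-map⁻ uncons i
    ... | _ ∷ _ , j , refl = j
    bound : ∀ (l : List (Vec ℕ (suc m))) → ∃ λ b → ∀ {q w} → (q ∷ w) ∈ l → q ℕ.< b
    bound [] = 0 , λ ()
    bound ((q ∷ w) ∷ l) = let b , h = bound l in suc q ℕ.⊔ b ,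
      λ { (here refl) → ℕ.m≤m⊔n (suc q) b
        ; (there i) → ℕ.≤-trans (h i) (ℕ.m≤n⊔m (suc q) b) }
    -- `b` bounds the first coordinates still to be scanned and `n` the new numbers still available,
    -- of which each value in use takes one. `N` stays fixed as the bound for the remaining
    -- coordinates.
    go : ∀ b n (l : List (ℕ × Vec ℕ m)) → (∀ {q w} → (q , w) ∈ l → q ℕ.< b) →
      length l ℕ.≤ n → length l ℕ.≤ N →
      ∃₂ λ (ι : E (sys d (suc m))) (κ : ℕ × Vec ℕ m → Vec ℕ (suc m)) →
      ∀ {q w} → (q , w) ∈ l → rename (suc m) ι (κ (q , w)) ≡ q ∷ w ×
        head (κ (q , w)) ℕ.≤ n × VecAll.All (ℕ._≤ N) (tail (κ (q , w)))
    go zero n l h _ _ = [] , (λ { (q , w) → q ∷ w }) , λ i → ⊥-elim (ℕ.n≮0 (h i))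
    go (suc b) n l h len-n len-N with slice ℕ._≟_ 0 l in eq | compress m N (slice ℕ._≟_ 0 l) zeros-N
      where
      zeros-N : length (slice ℕ._≟_ 0 l) ℕ.≤ N
      zeros-N = ℕ.≤-trans (ℕ.m≤m+n _ _) (ℕ.≤-trans (ℕ.≤-reflexive (length-lower l)) len-N)
    ... | [] | _ =
      let ι , κ , rec = go b n (lower l) (λ i → ℕ.≤-pred (h (∈-lower⁻ l i)))
            (ℕ.≤-trans lower-len len-n) (ℕ.≤-trans lower-len len-N)
      in nothing ∷ ι , (λ { (zero , w) → zero ∷ w ; (suc q , w) → κ (q , w) }) ,
         λ { {zero} {w} i → ⊥-elim (no-zero (subst (w ∈_) eq (∈-slice⁺ ℕ._≟_ i)))
           ; {suc q} {w} i → let e , ps = rec (∈-lower⁺ i) in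
               trans (rename-nothing m ι (κ (q , w))) (cong bump-head e) , ps }
      where
      no-zero : ∀ {w : Vec ℕ m} → ¬ (w ∈ [])
      no-zero ()
      lower-len : length (lower l) ℕ.≤ length l
      lower-len = ℕ.≤-trans (ℕ.m≤n+m _ _) (ℕ.≤-reflexive (length-lower l))
    ... | z ∷ zs | e₀ , κ₀ , rec₀ = with-zeros n (ℕ.≤-trans lower-len len-n)
      where
      lower-len : suc (length (lower l)) ℕ.≤ length l
      lower-len = ℕ.≤-trans (ℕ.+-monoˡ-≤ (length (lower l)) {1} {length (slice ℕ._≟_ 0 l)}
          (subst (λ s → 1 ℕ.≤ length s) (sym eq) (s≤s z≤n)))
        (ℕ.≤-reflexive (length-lower l))
      with-zeros : ∀ n → suc (length (lower l)) ℕ.≤ n →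
        ∃₂ λ (ι : E (sys d (suc m))) (κ : ℕ × Vec ℕ m → Vec ℕ (suc m)) →
        ∀ {q w} → (q , w) ∈ l → rename (suc m) ι (κ (q , w)) ≡ q ∷ w ×
          head (κ (q , w)) ℕ.≤ n × VecAll.All (ℕ._≤ N) (tail (κ (q , w)))
      with-zeros (suc n) (s≤s len) =
        let ι , κ , rec = go b n (lower l) (λ i → ℕ.≤-pred (h (∈-lower⁻ l i))) len
              (ℕ.≤-trans (ℕ.n≤1+n _) (ℕ.≤-trans lower-len len-N))
        in just e₀ ∷ ι , (λ { (zero , w) → zero ∷ κ₀ w ; (suc q , w) → bump-head (κ (q , w)) }) ,
           λ { {zero} {w} i → let e , ps = rec₀ (subst (w ∈_) eq (∈-slice⁺ ℕ._≟_ i)) in cong (zero ∷_) e , z≤n , ps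
             ; {suc q} {w} i → let e , p , ps = rec (∈-lower⁺ i) in
                 trans (rename-just m e₀ ι (κ (q , w))) (cong bump-head e) , bump-bounds (κ (q , w)) p ps }
        where
        bump-bounds : ∀ v → head v ℕ.≤ n → VecAll.All (ℕ._≤ N) (tail v) →
          head (bump-head v) ℕ.≤ suc n × VecAll.All (ℕ._≤ N) (tail (bump-head v))
        bump-bounds (_ ∷ _) p ps = s≤s p , ps

-- Translation of Petri nets

map-cong-∈ : ∀ {A B : Set} {f g : A → B} l → (∀ {x} → x ∈ l → f x ≡ g x) → map f l ≡ map g l
map-cong-∈ l h = map-cong-local (All.tabulate h)

vectors : ℕ → ∀ m → List (Vec ℕ m)
vectors N zero    = [] ∷ []
vectors N (suc m) = cartesianProductWith _∷_ (upTo (suc N)) (vectors N m)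

∈-vectors : ∀ {N m} {v : Vec ℕ m} → VecAll.All (ℕ._≤ N) v → v ∈ vectors N m
∈-vectors []       = here refl
∈-vectors (p ∷ ps) = ∈-cartesianProductWith⁺ _∷_ (∈-upTo⁺ (s≤s p)) (∈-vectors ps)

step-resp : ∀ {ℓ d} {T : Presentation ℓ d} {s s′ t t′} → s ↭ s′ → t ↭ t′ → Step T s t → Step T s′ t′
step-resp p q (ι , emb , hh , hh∈ , g , s↭ , t↭) =
  ι , emb , hh , hh∈ , g , ↭-trans (↭-sym p) s↭ , ↭-trans (↭-sym q) t↭

reach-trans : ∀ {ℓ d} {T : Presentation ℓ d} {s t u} → Reach T s t → Reach T t u → Reach T s u
reach-trans (inj₁ p) (inj₁ q) = inj₁ (↭-trans p q)
reach-trans (inj₁ p) (inj₂ (v , st , sts)) = inj₂ (v , step-resp (↭-sym p) ↭-refl st , sts)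
reach-trans {T = T} {t = t} {u} (inj₂ (v , st , sts)) (inj₁ q) = inj₂ (last st sts)
  where
  last : ∀ {s v} → Step T s v → Star (Step T) v t → ∃ λ w → Step T s w × Star (Step T) w u
  last st ε = u , step-resp ↭-refl q st , ε
  last {v = v} st (st′ ◅ sts) = let w , st″ , sts′ = last st′ sts in v , st , st″ ◅ sts′
reach-trans (inj₂ (v , st , sts)) (inj₂ (_ , st′ , sts′)) = inj₂ (v , st , sts ◅◅ (st′ ◅ sts′))

support : ∀ {ℓ d} → Monomial ℓ d → List (Vec ℚ ℓ)
support = map proj₁

values : ∀ {ℓ d} {T : Presentation ℓ d} {u t} → Star (Step T) u t → List (Vec ℚ ℓ)
values {u = u} ε          = support u
values {u = u} (_ ◅ sts) = support u ++ values sts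

support⊆values : ∀ {ℓ d} {T : Presentation ℓ d} {u t} (sts : Star (Step T) u t) {z} →
  z ∈ u → proj₁ z ∈ values sts
support⊆values ε         i = ∈-map⁺ proj₁ i
support⊆values (_ ◅ sts) i = ∈-++⁺ˡ (∈-map⁺ proj₁ i)

module Translation (ℓ d : ℕ) (T : Presentation ℓ d) where
  open Variables d
  open Renaming d

  m : ℕ
  m = double ℓ

  open MonomialSystem (sys d m)
  open Completion (sys d m)

  -- An element of a rule together with the variable chosen to represent it.
  Label : Set
  Label = Vec ℚ ℓ × Vec ℕ m × Fin d

  source : Label → Elem ℓ d
  source (x , v , p) = x , p

  target : Label → Var m
  target (x , v , p) = v , p

  labellings : ℕ → Monomial ℓ d → List (List Label)
  labellings N []            = [] ∷ []
  labellings N ((x , p) ∷ h) =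
    cartesianProductWith (λ v l → (x , v , p) ∷ l) (vectors N m) (labellings N h)

  label : (Elem ℓ d → Vec ℕ m) → Elem ℓ d → Label
  label κ u = proj₁ u , κ u , proj₂ u

  ∈-labellings : ∀ {N} κ h → (∀ {u} → u ∈ h → VecAll.All (ℕ._≤ N) (κ u)) →
    map (label κ) h ∈ labellings N h
  ∈-labellings κ []      b = here refl
  ∈-labellings κ (u ∷ h) b = ∈-cartesianProductWith⁺ (λ v l → (proj₁ u , v , proj₂ u) ∷ l)
    (∈-vectors (b (here refl))) (∈-labellings κ h (b ∘ there))

  labellings-source : ∀ {N} h {l} → l ∈ labellings N h → map source l ≡ h
  labellings-source []      (here refl) = refl
  labellings-source {N} ((x , p) ∷ h) i
    with ∈-cartesianProductWith⁻ (λ v l → (x , v , p) ∷ l) (vectors N m) (labellings N h) i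
  ... | v , l , _ , j , refl = cong ((x , p) ∷_) (labellings-source h j)

  Agree : Label → Label → Set
  Agree (x , v , _) (y , w , _) = cmpω ℓ v w ≡ cmpTree x y

  -- Both sides of a pair are tested together, so that a value shared by them keeps a single vector:
  -- comparing a value with itself forces equal vectors at all its occurrences.
  Compatible : List Label × List Label → Set
  Compatible (l , l′) = All.All (λ z → All.All (Agree z) (l ++ l′)) (l ++ l′)

  compatible? : ∀ ll → Dec (Compatible ll)
  compatible? (l , l′) = All.all? (λ { (x , v , _) →
    All.all? (λ { (y , w , _) → cmpω ℓ v w ≟ᵀ cmpTree x y }) (l ++ l′) }) (l ++ l′)

  translate : List Label × List Label → Mono m × Mono m
  translate (l , l′) = encode m (map target l) , encode m (map target l′)

  labelled : Monomial ℓ d × Monomial ℓ d → List (List Label × List Label)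
  labelled (h , h′) = filter compatible? (cartesianProduct (labellings N h) (labellings N h′))
    where
    -- The bound that `compress` gives for the coordinates is the number of vectors, one for each
    -- occurrence in the pair.
    N = length (h ++ h′)

  generators : Rules
  generators = concatMap (map translate ∘ labelled) T

  infix 4 _∼ₜ_
  _∼ₜ_ : Mono m → Mono m → Set
  _∼ₜ_ = _∼_ generators

  module Soundness (reversible : Reversible T) (ρ : Vec ℕ m → Vec ℚ ℓ)
                   (ρ-cmp : ∀ v w → cmpTree (ρ v) (ρ w) ≡ cmpω ℓ v w) where

    interpret : Mono m → Monomial ℓ d
    interpret x = map (map₁ ρ) (decode m x)

    interpret-≈ : ∀ {x y} → x ≈ y → interpret x ↭ interpret y
    interpret-≈ p = map⁺ (map₁ ρ) (decode-≈ m p)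

    interpret-instance : ∀ g e vs →
      interpret (g + app e (encode m vs)) ↭ interpret g ++ map (map₁ (ρ ∘ rename m e)) vs
    interpret-instance g e vs = ↭-trans (map⁺ (map₁ ρ) (↭-trans (decode-+ m g _)
        (++⁺ ↭-refl (↭-trans (decode-≈ m (app-encode m e vs)) (decode-encode m _)))))
      (↭-reflexive (trans (map-++ (map₁ ρ) (decode m g) _)
        (cong (interpret g ++_) (sym (map-∘ vs)))))

    -- A labelled pair only prescribes the images of finitely many values. Compatibility makes this
    -- prescription a partial isomorphism, and `extend` turns it into the embedding of the whole
    -- structure that a transition demands.
    rewrite⇒step : ∀ {x y} → Rewrite generators x y → Step T (interpret x) (interpret y)
    rewrite⇒step (rewriting r∈ g e x≈ y≈)
      with find (∈-concatMap⁻ (map translate ∘ labelled) {xs = T} r∈)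
    ... | (h , h′) , hh∈ , j with ∈-map⁻ translate j
    ...   | (l , l′) , k , refl with ∈-filter⁻ compatible? {xs = cartesianProduct (labellings _ h) (labellings _ h′)} k
    ...     | k′ , compatible with ∈-cartesianProduct⁻ (labellings _ h) (labellings _ h′) k′
    ...       | l∈ , l′∈ =
      ι , cmpTree⇒emb θ θ-cmp , (h , h′) , hh∈ , interpret g ,
      ↭-trans (interpret-≈ x≈) (↭-trans (interpret-instance g e (map target l))
        (↭-reflexive (cong (interpret g ++_) (instance≡ h l (labellings-source h l∈) (∈-++⁺ˡ {ys = l′}))))) ,
      ↭-trans (interpret-≈ y≈) (↭-trans (interpret-instance g e (map target l′))
        (↭-reflexive (cong (interpret g ++_) (instance≡ h′ l′ (labellings-source h′ l′∈) (∈-++⁺ʳ l)))))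
      where
      moved : Label → Vec ℚ ℓ × Vec ℚ ℓ
      moved (x , v , _) = x , ρ (rename m e v)
      moved-compatible : ∀ {z z′} → z ∈ map moved (l ++ l′) → z′ ∈ map moved (l ++ l′) →
        cmpTree (proj₁ z) (proj₁ z′) ≡ cmpTree (proj₂ z) (proj₂ z′)
      moved-compatible i j with ∈-map⁻ moved i | ∈-map⁻ moved j
      ... | (x , v , _) , i′ , refl | (y , w , _) , j′ , refl = sym
        (trans (ρ-cmp _ _) (trans (rename-cmp ℓ e v w) (All.lookup (All.lookup compatible i′) j′)))
      extension = extend ℓ (map moved (l ++ l′)) moved-compatible
      θ = proj₁ extension
      θ-cmp = proj₁ (proj₂ extension)
      ι : Elem ℓ d → Elem ℓ d
      ι (x , p) = θ x , p
      instance≡ : ∀ k (n : List Label) → map source n ≡ k → (∀ {z} → z ∈ n → z ∈ l ++ l′) →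
        map (map₁ (ρ ∘ rename m e)) (map target n) ≡ map ι k
      instance≡ _ n refl n⊆ = trans (sym (map-∘ n)) (trans
        (map-cong-∈ n λ {z} i → cong (_, proj₂ (source z)) (sym (proj₂ (proj₂ extension) (∈-map⁺ moved (n⊆ i)))))
        (map-∘ n))

    sound : ∀ {x y} → x ∼ₜ y → Reach T (interpret x) (interpret y)
    sound (≈⇒∼ p)       = inj₁ (interpret-≈ p)
    sound (rewrite⇒∼ r) = inj₂ (_ , rewrite⇒step r , ε)
    -- The congruence is symmetric while transitions are directed; reversibility closes this gap.
    sound (∼-sym p)     = reversible _ _ (sound p)
    sound (∼-trans p q) = reach-trans (sound p) (sound q)

  module Completeness (P F : List (Vec ℚ ℓ)) where

    translation : Monomial ℓ d → Mono m
    translation u = encode m (map (map₁ (code ℓ P F)) u)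

    translation-↭ : ∀ {u v} → u ↭ v → translation u ≈ translation v
    translation-↭ p = encode-↭ (map⁺ (map₁ (code ℓ P F)) p)

    Within : Monomial ℓ d → Set
    Within u = ∀ {z} → z ∈ u → proj₁ z ∈ F

    -- The codes of the values that `ι` produces are compressed: the bounded vectors `κ` select one
    -- of the generators, and the renaming `e` carries it back to the actual codes.
    step⇒∼ : ∀ {u u′} → Within u → Within u′ → Step T u u′ → translation u ∼ₜ translation u′
    step⇒∼ {u} {u′} u⊆ u′⊆ (ι , emb , (h , h′) , hh∈ , g , u↭ , u′↭) =
      rewrite⇒∼ (rewriting
        (∈-concatMap⁺ (map translate ∘ labelled) (lose hh∈ (∈-map⁺ translate
          (∈-filter⁺ compatible? (∈-cartesianProduct⁺
            (∈-labellings κ h (proj₂ ∘ factors ∘ ∈-++⁺ˡ))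
            (∈-labellings κ h′ (proj₂ ∘ factors ∘ ∈-++⁺ʳ h))) compatible))))
        (translation g) e
        (instance≈ u↭ (∈-++⁺ˡ {ys = h′})) (instance≈ u′↭ (∈-++⁺ʳ h)))
      where
      φ : Elem ℓ d → Vec ℕ m
      φ z = code ℓ P F (proj₁ (ι z))
      N : ℕ
      N = length (h ++ h′)
      compressed : Compressed m N (map φ (h ++ h′))
      compressed = compress m N (map φ (h ++ h′)) (ℕ.≤-reflexive (length-map φ (h ++ h′)))
      e = proj₁ compressed
      κ : Elem ℓ d → Vec ℕ m
      κ z = proj₁ (proj₂ compressed) (φ z)
      factors : ∀ {z} → z ∈ h ++ h′ → rename m e (κ z) ≡ φ z × VecAll.All (ℕ._≤ N) (κ z)
      factors i = proj₂ (proj₂ compressed) (∈-map⁺ φ i)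
      ι∈F : ∀ {z} → z ∈ h ++ h′ → proj₁ (ι z) ∈ F
      ι∈F i with ∈-++⁻ h i
      ... | inj₁ j = u⊆ (∈-resp-↭ (↭-sym u↭) (∈-++⁺ʳ g (∈-map⁺ ι j)))
      ... | inj₂ j = u′⊆ (∈-resp-↭ (↭-sym u′↭) (∈-++⁺ʳ g (∈-map⁺ ι j)))
      agree : ∀ {z z′} → z ∈ h ++ h′ → z′ ∈ h ++ h′ → Agree (label κ z) (label κ z′)
      agree {z} {z′} i j = begin
        cmpω ℓ (κ z) (κ z′)                          ≡⟨ rename-cmp ℓ e (κ z) (κ z′) ⟨
        cmpω ℓ (rename m e (κ z)) (rename m e (κ z′)) ≡⟨ cong₂ (cmpω ℓ) (proj₁ (factors i)) (proj₁ (factors j)) ⟩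
        cmpω ℓ (φ z) (φ z′)                          ≡⟨ code-cmp ℓ P F (ι∈F i) (ι∈F j) ⟩
        cmpTree (proj₁ (ι z)) (proj₁ (ι z′))         ≡⟨ emb⇒cmpTree emb z z′ ⟩
        cmpTree (proj₁ z) (proj₁ z′)                 ∎
        where open ≡-Reasoning
      compatible : Compatible (map (label κ) h , map (label κ) h′)
      compatible = subst (λ l → All.All (λ z → All.All (Agree z) l) l) (map-++ (label κ) h h′)
        (All.tabulate λ i → All.tabulate λ j → all i j)
        where
        all : ∀ {z z′} → z ∈ map (label κ) (h ++ h′) → z′ ∈ map (label κ) (h ++ h′) → Agree z z′
        all i j with ∈-map⁻ (label κ) i | ∈-map⁻ (label κ) j
        ... | _ , i′ , refl | _ , j′ , refl = agree i′ j′
      instance≡ : ∀ k → (∀ {z} → z ∈ k → z ∈ h ++ h′) →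
        map (map₁ (code ℓ P F)) (map ι k) ≡ map (map₁ (rename m e)) (map target (map (label κ) k))
      instance≡ k k⊆ = trans (sym (map-∘ k)) (trans
        (map-cong-∈ k λ {z} i → cong₂ _,_ (sym (proj₁ (factors (k⊆ i)))) (emb⇒place emb (proj₁ z) (proj₂ z)))
        (trans (map-∘ k) (cong (map (map₁ (rename m e))) (map-∘ k))))
      instance≈ : ∀ {w k} → w ↭ g ++ map ι k → (∀ {z} → z ∈ k → z ∈ h ++ h′) →
        translation w ≈ translation g + app e (encode m (map target (map (label κ) k)))
      instance≈ {w} {k} w↭ k⊆ = ≈-trans (translation-↭ w↭) (≈-trans
        (≈-reflexive (cong (encode m) (trans (map-++ (map₁ (code ℓ P F)) g (map ι k))
          (cong (map (map₁ (code ℓ P F)) g ++_) (instance≡ k k⊆)))))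
        (≈-trans (encode-++ (map (map₁ (code ℓ P F)) g) _)
          (∙-cong ≈-refl (≈-sym (app-encode m e (map target (map (label κ) k)))))))

    steps⇒∼ : ∀ {u t} (sts : Star (Step T) u t) → (∀ {x} → x ∈ values sts → x ∈ F) →
      translation u ∼ₜ translation t
    steps⇒∼ ε _ = ≈⇒∼ ≈-refl
    steps⇒∼ {u} (st ◅ sts) v⊆ = ∼-trans
      (step⇒∼ (λ i → v⊆ (∈-++⁺ˡ (∈-map⁺ proj₁ i))) (λ i → v⊆ (∈-++⁺ʳ (support u) (support⊆values sts i))) st)
      (steps⇒∼ sts (λ i → v⊆ (∈-++⁺ʳ (support u) i)))

  reach-decidable : Reversible T → ∀ s t → Dec (Reach T s t)
  reach-decidable reversible s t = map′ from to (congruence-decidable generators (translation s) (translation t))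
    where
    P : List (Vec ℚ ℓ)
    P = support s ++ support t
    open Completeness P P using (translation; translation-↭)

    -- Each derivation comes with its own `F`, whereas the decision is made once, with `P` in its
    -- place; both give the same translations of `s` and `t`.
    fixed : ∀ F u → (∀ {z} → z ∈ u → proj₁ z ∈ P) → Completeness.translation P F u ≡ translation u
    fixed F u u⊆ = cong (encode m) (map-cong-∈ u λ {z} i → cong (_, proj₂ z) (code-fixed ℓ P F P (u⊆ i)))

    to : Reach T s t → translation s ∼ₜ translation t
    to (inj₁ p) = ≈⇒∼ (translation-↭ p)
    to (inj₂ (u , st , sts)) = subst₂ _∼ₜ_
      (fixed F s (∈-++⁺ˡ ∘ ∈-map⁺ proj₁)) (fixed F t (∈-++⁺ʳ (support s) ∘ ∈-map⁺ proj₁))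
      (Completeness.steps⇒∼ P F (st ◅ sts) id)
      where
      F = values (st ◅ sts)

    -- `embed` after `code` preserves comparisons between points of `P` but moves the points. The
    -- map `θ` extended from these pairs returns them, so interpreting the translations gives back
    -- `s` and `t` themselves.
    pair : Vec ℚ ℓ → Vec ℚ ℓ × Vec ℚ ℓ
    pair x = embed ℓ (code ℓ P P x) , x

    pair-compatible : ∀ {z z′} → z ∈ map pair P → z′ ∈ map pair P →
      cmpTree (proj₁ z) (proj₁ z′) ≡ cmpTree (proj₂ z) (proj₂ z′)
    pair-compatible i j with ∈-map⁻ pair i | ∈-map⁻ pair j
    ... | x , i′ , refl | y , j′ , refl = trans (embed-cmp ℓ _ _) (code-cmp ℓ P P i′ j′)

    extension = extend ℓ (map pair P) pair-compatible
    θ = proj₁ extension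

    open Soundness reversible (θ ∘ embed ℓ) (λ v w → trans (proj₁ (proj₂ extension) _ _) (embed-cmp ℓ v w))

    interpret-translation : ∀ u → (∀ {z} → z ∈ u → proj₁ z ∈ P) → interpret (translation u) ↭ u
    interpret-translation u u⊆ = ↭-trans (map⁺ (map₁ (θ ∘ embed ℓ)) (decode-encode m _))
      (↭-reflexive (trans (sym (map-∘ u)) (map-id-local (All.tabulate λ {z} i →
        cong (_, proj₂ z) (proj₂ (proj₂ extension) (∈-map⁺ pair (u⊆ i)))))))

    from : translation s ∼ₜ translation t → Reach T s t
    from p = reach-trans (inj₁ (↭-sym (interpret-translation s (∈-++⁺ˡ ∘ ∈-map⁺ proj₁))))
      (reach-trans (sound p) (inj₁ (interpret-translation t (∈-++⁺ʳ (support s) ∘ ∈-map⁺ proj₁))))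

theorem8p3 : (ℓ : ℕ) → 1 ≤ ℓ → (d : ℕ) (T : Presentation ℓ d) (s t : Monomial ℓ d)
    → Reversible T → Dec (Reach T s t)
theorem8p3 ℓ _ d T s t reversible = Translation.reach-decidable ℓ d T reversible s t
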